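{- Let $n\ge 5$ be an integer. The number of pairwise nonisomorphic $(-2)$-critical trees with $n$ vertices equals: - $\left\lfloor\frac{n}{4}\right\rfloor^{2}-1$ if $n\equiv 0 \pmod 4$; - $\left\lfloor\frac{n}{4}\right\rfloor^{2}$ if $n\equiv 1 \pmod 4$; - $\left\lfloor\frac{n}{4}\right\rfloor\left(\left\lfloor\frac{n}{4}\right\rfloor+1\right)-1$ if $n\equiv 2 \pmod 4$; - $\left\lfloor\frac{n}{4}\right\rfloor\left(\left\lfloor\frac{n}{4}\right\rfloor+1\right)$ otherwise (i.e. if $n\equiv 3\pmod 4$).
   Context: Graphs are finite, simple and undirected. For a graph $G=(V,E)$, a module of $G$ is a subset $M\subseteq V$ such that every vertex outside $M$ is adjacent to all or to none of the vertices of $M$. The modules $\emptyset$, $\{x\}$ ($x\in V$) and $V$ are trivial. $G$ is decomposable if it has a nontrivial module; $G$ is prime if it has at least four vertices and all its modules are trivial. A vertex $x$ of a prime graph $G$ is critical if $G-x$ (the subgraph induced on $V\setminus\{x\}$) is decomposable, and non-critical otherwise. A prime graph with exactly $k$ non-critical vertices is called $(-k)$-critical. -}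

module Defs where

open import Data.Nat.Base using (ℕ; suc; _+_; _≤_)
open import Data.Fin.Base using (Fin; zero; suc; inject₁; fromℕ; punchIn)
open import Data.Fin.Permutation as Perm using (Permutation′; _⟨$⟩ʳ_)
open import Data.Fin.Subset using (Subset; _∈_; _∉_; ⊥; ⊤; ⁅_⁆; ∣_∣)
open import Data.Product.Base using (Σ; ∃-syntax; _×_; _,_; proj₁)
open import Data.Sum.Base using (_⊎_)
open import Function.Base using (id; _∘_)
open import Function.Bundles using (_⇔_; mk⇔; Equivalence; Bijection)
open import Function.Definitions using (Injective)
open import Level using (0ℓ; _⊔_) renaming (suc to lsuc)
open import Relation.Binary.Bundles using (Setoid)
open import Relation.Binary.Core using (Rel)
open import Relation.Binary.Definitions using (Decidable; Irreflexive; Symmetric)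
open import Relation.Binary.PropositionalEquality
  using (_≡_; cong; subst₂) renaming (setoid to ≡-setoid; sym to ≡-sym)
open import Relation.Binary.Construct.Closure.ReflexiveTransitive using (Star)
import Relation.Binary.Construct.On as On
open import Relation.Nullary.Negation.Core using (¬_)

record Graph (n : ℕ) : Set₁ where
  infix 4 _~_ _~?_
  field
    _~_    : Rel (Fin n) 0ℓ
    _~?_   : Decidable _~_
    sym    : Symmetric _~_
    irrefl : Irreflexive _≡_ _~_

private
  variable
    n : ℕ

-- The vertices other than x are relabelled in order, so punchIn x sends
-- each vertex of G - x to the vertex of G that it comes from.
delete : Graph (suc n) → Fin (suc n) → Graph n
delete G x = record
  { _~_    = λ u v → punchIn x u ~ punchIn x v
  ; _~?_   = λ u v → punchIn x u ~? punchIn x v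
  ; sym    = sym
  ; irrefl = λ u≡v → irrefl (cong (punchIn x) u≡v)
  }
  where open Graph G

IsModule : Graph n → Subset n → Set
IsModule G M = ∀ x → x ∉ M → (∀ y → y ∈ M → x ~ y) ⊎ (∀ y → y ∈ M → ¬ (x ~ y))
  where open Graph G

Trivial : Subset n → Set
Trivial M = M ≡ ⊥ ⊎ (∃[ x ] M ≡ ⁅ x ⁆) ⊎ M ≡ ⊤

Decomposable : Graph n → Set
Decomposable G = ∃[ M ] (IsModule G M × ¬ Trivial M)

Prime : Graph n → Set
Prime {n} G = 4 ≤ n × (∀ M → IsModule G M → Trivial M)

Critical : Graph n → Fin n → Set
Critical {suc n} G x = Decomposable (delete G x)

-- S is the set of non-critical vertices.
MinusCritical : ℕ → Graph n → Set
MinusCritical {n} k G =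
  Prime G × (∃[ S ] (∣ S ∣ ≡ k × (∀ x → x ∈ S ⇔ (¬ Critical G x))))

Connected : Graph n → Set
Connected G = ∀ u v → Star _~_ u v
  where open Graph G

-- c 0, …, c (m + 2) are distinct, consecutive ones are adjacent, and the
-- last is adjacent to the first.
Cycle : Graph n → Set
Cycle {n} G = ∃[ m ] Σ (Fin (3 + m) → Fin n) λ c →
    Injective _≡_ _≡_ c
  × (∀ (i : Fin (2 + m)) → c (inject₁ i) ~ c (suc i))
  × c (fromℕ (2 + m)) ~ c zero
  where open Graph G

IsTree : Graph n → Set
IsTree G = Connected G × ¬ Cycle G

infix 4 _≅_

_≅_ : Rel (Graph n) 0ℓ
_≅_ {n} G H = Σ (Permutation′ n) λ π →
  ∀ u v → (u G.~ v) ⇔ ((π ⟨$⟩ʳ u) H.~ (π ⟨$⟩ʳ v))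
  where
  module G = Graph G
  module H = Graph H

graphSetoid : ℕ → Setoid (lsuc 0ℓ) 0ℓ
graphSetoid n = record
  { Carrier       = Graph n
  ; _≈_           = _≅_
  ; isEquivalence = record
    { refl  = Perm.id , λ _ _ → mk⇔ id id
    ; sym   = λ {G} {H} → ≅-sym {G} {H}
    ; trans = λ (π , f) (ρ , g) → π Perm.∘ₚ ρ , λ u v →
        mk⇔ (to (g _ _) ∘ to (f u v)) (from (f u v) ∘ from (g _ _))
    }
  }
  where
  open Equivalence using (to; from)

  ≅-sym : {G H : Graph n} → G ≅ H → H ≅ G
  ≅-sym {G} {H} (π , f) = Perm.flip π , λ u v → mk⇔
    (λ e → from (f _ _)
      (subst₂ (Graph._~_ H) (≡-sym (Perm.inverseʳ π)) (≡-sym (Perm.inverseʳ π)) e))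
    (λ e → subst₂ (Graph._~_ H) (Perm.inverseʳ π) (Perm.inverseʳ π) (to (f _ _) e))

minusCriticalTrees : ℕ → ℕ → Setoid (lsuc 0ℓ) 0ℓ
minusCriticalTrees k n =
  On.setoid {B = Σ (Graph n) λ G → IsTree G × MinusCritical k G} (graphSetoid n) proj₁

-- The number of equivalence classes of S is k.
HasCardinality : ∀ {a ℓ} → Setoid a ℓ → ℕ → Set (a ⊔ ℓ)
HasCardinality S k = Bijection (≡-setoid (Fin k)) S

{-# OPTIONS --safe #-}
module Submission where

-- A tree on at least four vertices is prime exactly when no two leaves share
-- a neighbour.  From five vertices on, a vertex of a prime tree is
-- non-critical exactly when it is a loose leaf, that is, its neighbour does
-- not have degree two with a further neighbour that carries a leaf.  Join the
-- two loose leaves of a (-2)-critical tree by a path.  A branch off the path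
-- contains no loose leaf and is therefore a leaf or a leg of length two; the
-- first never occurs, and the second only at the neighbours of the two ends.
-- So the tree is a barbell: a path with a legs of length two at its second
-- vertex and b at its last but one.  The degrees of these two vertices recover
-- {a , b}, hence the isomorphism class, and the admissible pairs a ≤ b are
-- counted by a recursion on a that replaces n by n - 4.

open import Data.Nat.Base
  using (ℕ; zero; suc; _+_; _*_; _∸_; _^_; _≤_; _<_; z≤n; s≤s; s≤s⁻¹; ⌊_/2⌋; ⌈_/2⌉)
open import Data.Nat.DivMod using (_/_; _%_; m≡m%n+[m/n]*n)
open import Data.Nat.Properties as ℕₚ using (≤-refl; ≤-trans; n≤1+n; m∸n≤m)
open import Data.Nat.Solver using (module +-*-Solver)
open import Data.Bool.Base using (true)
open import Data.Empty using (⊥-elim)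
open import Data.Fin.Base
  using (Fin; zero; suc; toℕ; fromℕ; inject₁; fromℕ<; punchIn; punchOut; opposite)
open import Data.Fin.Induction using (<-weakInduction; >-weakInduction)
open import Data.Fin.Permutation as Perm using (↔⇒≡; _⟨$⟩ʳ_; _⟨$⟩ˡ_)
open import Data.Fin.Properties as Finₚ
  using (any?; all?; _≟_; toℕ-injective; toℕ-inject₁; toℕ-fromℕ; toℕ-fromℕ<; toℕ<n; punchInᵢ≢i;
    punchIn-injective; punchIn-punchOut; +↔⊎; injective⇒≤; opposite-prop; opposite-involutive)
open import Data.Fin.Subset using (Subset; _∈_; _∉_; ⁅_⁆; ∣_∣; _∪_; ∁; outside; inside)
open import Data.Fin.Subset.Properties
  using (Empty-unique; _∈?_; nonempty?; x∈p⇒x∉∁p; x∈p∪q⁺; x∈p∪q⁻; x∈⁅x⁆; x∈⁅y⁆⇒x≡y; x∈∁p⇒x∉p;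
    x∉p⇒x∈∁p; x∉∁p⇒x∈p; ∈⊤; ∉⊥; ∣⁅x⁆∣≡1; ∣∁p∣≡n∸∣p∣; ∪-identityʳ; ∪-identityˡ; ⊆-antisym; ⊆⊤)
open import Data.List.Base using (List; []; _∷_; _++_; map; filter; upTo; allFin; lookup; length)
open import Data.List.Membership.Propositional using () renaming (_∈_ to _∈ˡ_)
open import Data.List.Membership.Propositional.Properties
  using (∈-map⁺; ∈-map⁻; ∈-++⁺ˡ; ∈-++⁺ʳ; ∈-++⁻; ∈-upTo⁺; ∈-upTo⁻; ∈-filter⁺; ∈-filter⁻; ∈-allFin;
    ∈-lookup)
open import Data.List.Properties using (length-map; length-++; length-upTo)
import Data.List.Relation.Unary.All as All
open import Data.List.Relation.Unary.AllPairs using ([]; _∷_)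
open import Data.List.Relation.Unary.Any using (index)
open import Data.List.Relation.Unary.Any.Properties using (lookup-index)
open import Data.List.Relation.Unary.Unique.Propositional using (Unique)
import Data.List.Relation.Unary.Unique.Propositional.Properties as Unique
open import Data.Product.Base using (Σ; ∃; ∃-syntax; ∃₂; _×_; _,_; proj₁; proj₂)
open import Data.Sum.Base as Sum using (_⊎_; inj₁; inj₂; [_,_]′)
open import Data.Sum.Function.Propositional using (_⊎-↔_)
open import Data.Vec.Base using (tabulate; _∷_; here; there)
open import Data.Vec.Properties using (lookup∘tabulate; []=⇒lookup; lookup⇒[]=)
open import Function.Base using (_∘_; id)
open import Function.Bundles using (_⇔_; mk⇔; Equivalence; _↔_; mk↔ₛ′; Inverse; mk↣)
open import Function.Properties.Inverse using (↔-refl; ↔-sym; ↔-trans)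
open import Level using (0ℓ)
open import Relation.Binary.Bundles using (Setoid)
open import Relation.Binary.Construct.Closure.ReflexiveTransitive as Star using (Star; ε; _◅_; _◅◅_)
open import Relation.Binary.Core using (Rel)
open import Relation.Binary.Definitions using (Decidable; DecidableEquality; Irreflexive; Symmetric)
open import Relation.Binary.PropositionalEquality
  using (_≡_; _≢_; refl; sym; trans; cong; cong₂; subst; subst₂; ≢-sym; module ≡-Reasoning)
open import Relation.Nullary using (¬_; Dec; yes; no; does; contradiction)
open import Relation.Nullary.Decidable
  using (¬?; _×-dec_; _⊎-dec_; _→-dec_; map′; via-injection; dec-true; decidable-stable)
open import Defs

open +-*-Solver using (solve; _:+_; _:*_; _:=_; con)

-- Walks without backtracking

-- Paths are replaced throughout by reduced walks. Being reduced is a condition on nearby vertices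
-- only, so walks can be extended, reversed and cut without carrying distinctness along, and
-- acyclicity becomes the single statement that a reduced walk never repeats a vertex. The
-- isomorphism with a barbell is likewise checked only at each vertex and its neighbours;
-- connectedness and acyclicity turn it into a bijection. With `c` path vertices between the two
-- hubs, `n` is `4 + c + 2 (a + b)`. The only barbells to be excluded have `c` zero and a hub
-- without legs, since there an end of the path is anchored at the opposite hub. Up to symmetry this
-- is one shape when `n` is even and none when `n` is odd, which is the source of the `∸ 1` in the
-- two even residue classes.

∸-step : ∀ {i L} → i < L → L ∸ i ≡ suc (L ∸ suc i)
∸-step {zero}  {suc L} _   = refl
∸-step {suc i} {suc L} i<L = ∸-step (s≤s⁻¹ i<L)

infixr 5 _◂_

_◂_ : {A : Set} → A → (ℕ → A) → ℕ → A
(a ◂ P) zero    = a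
(a ◂ P) (suc i) = P i

module Relational {A : Set} (_~_ : Rel A 0ℓ) where

  Pendant : A → A → Set
  Pendant y x = (y ~ x) × (∀ w → w ~ x → w ≡ y)

  TwinFree : Set
  TwinFree = ∀ {z u v} → Pendant z u → Pendant z v → u ≡ v

  Neck : A → A → A → Set
  Neck x y z = Pendant y x × (z ~ y) × (z ≢ x) × (∀ u → u ~ y → u ≡ x ⊎ u ≡ z)

  -- In a twin-free tree with at least five vertices, deleting the leaf x
  -- creates twins exactly when x is anchored: its neighbour y becomes a
  -- leaf at z, which already carries the leaf w.
  Anchored : A → Set
  Anchored x = ∃[ y ] ∃[ z ] ∃[ w ] (Neck x y z × Pendant z w)

  Loose : A → Set
  Loose x = (∃[ y ] Pendant y x) × ¬ Anchored x

  -- A walk is a total function of which only the values up to `L` are constrained; reversal,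
  -- shifting and restriction are then plain reindexing.
  record Reduced (L : ℕ) (P : ℕ → A) : Set where
    field
      adj : ∀ i → i < L → P i ~ P (suc i)
      nb  : ∀ i → suc i < L → P i ≢ P (suc (suc i))

  open Reduced public

  -- This form of acyclicity passes to induced subgraphs and is contradicted by any closed reduced
  -- walk, with no cycle to be extracted.
  Acyclic : Set
  Acyclic = ∀ L {P} → Reduced L P → ∀ i j → i ≤ L → j ≤ L → P i ≡ P j → i ≡ j

  single : ∀ {a b} → a ~ b → Reduced 1 (a ◂ λ _ → b)
  single a~b .adj zero    _        = a~b
  single a~b .adj (suc i) (s≤s ())
  single a~b .nb  i       (s≤s ())

  cons : ∀ {a L P} → a ~ P 0 → a ≢ P 1 → Reduced L P → Reduced (suc L) (a ◂ P)
  cons a~ a≢ r .adj zero    _   = a~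
  cons a~ a≢ r .adj (suc i) i<L = adj r i (s≤s⁻¹ i<L)
  cons a~ a≢ r .nb  zero    _   = a≢
  cons a~ a≢ r .nb  (suc i) i<L = nb r i (s≤s⁻¹ i<L)

  tail : ∀ {L P} → Reduced (suc L) P → Reduced L (P ∘ suc)
  tail r .adj i i<L = adj r (suc i) (s≤s i<L)
  tail r .nb  i i<L = nb r (suc i) (s≤s i<L)

  drop : ∀ i {L P} → Reduced (L + i) P → Reduced L (λ j → P (j + i))
  drop i r .adj j j<L = adj r (j + i) (ℕₚ.+-monoˡ-≤ i j<L)
  drop i r .nb  j j<L = nb r (j + i) (ℕₚ.+-monoˡ-≤ i j<L)

  restrict : ∀ {i L P} → i ≤ L → Reduced L P → Reduced i P
  restrict i≤L r .adj j j<i = adj r j (≤-trans j<i i≤L)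
  restrict i≤L r .nb  j j<i = nb r j (≤-trans j<i i≤L)

  module _ (~-sym : Symmetric _~_) where

    reverse : ∀ {L P} → Reduced L P → Reduced L (λ i → P (L ∸ i))
    reverse {L} {P} r .adj i i<L =
      ~-sym (subst (λ k → P (L ∸ suc i) ~ P k) (sym (∸-step i<L))
        (adj r (L ∸ suc i) (subst (_≤ L) (∸-step i<L) (m∸n≤m L i))))
    reverse {L} {P} r .nb i i<L eq = nb r (L ∸ suc (suc i)) (subst (_≤ L) two (m∸n≤m L i))
      (sym (trans (sym (cong P two)) eq))
      where
      two : L ∸ i ≡ suc (suc (L ∸ suc (suc i)))
      two = trans (∸-step (ℕₚ.<-trans (ℕₚ.n<1+n i) i<L)) (cong suc (∸-step i<L))

    -- Via x a v p: some reduced walk from x has a as its second vertex and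
    -- p, v as its last two.
    data Via (x a : A) : A → A → Set where
      start : x ~ a → Via x a a x
      step  : ∀ {v w p} → Via x a v p → v ~ w → w ≢ p → Via x a w v

    via-edge : ∀ {x a v p} → Via x a v p → p ~ v
    via-edge (start e)    = e
    via-edge (step _ e _) = e

    via-walk : ∀ {x a v p} → Via x a v p →
      ∃₂ λ L P → Reduced (suc L) P × P 0 ≡ v × P 1 ≡ p × P (suc L) ≡ x
    via-walk (start e) = 0 , _ , single (~-sym e) , refl , refl , refl
    via-walk (step v e w≢) with via-walk v
    ... | L , P , r , refl , refl , end =
      suc L , _ , cons (~-sym e) w≢ r , refl , refl , end

    module _ (_≟_ : DecidableEquality A) where

      -- A backtracking step cancels the last edge, so the walk stays reduced and keeps its second
      -- vertex `a` unless it shrinks to `x`.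
      via-extend : ∀ {x a v p w} → Via x a v p → v ~ w → w ≡ x ⊎ ∃ (Via x a w)
      via-extend {p = p} {w} π e with w ≟ p
      ... | no w≢p = inj₂ (_ , step π e w≢p)
      via-extend (start _)     e | yes refl = inj₁ refl
      via-extend (step π _ _)  e | yes refl = inj₂ (_ , π)

      reach : ∀ {x v} → Star _~_ x v → v ≡ x ⊎ ∃₂ λ a p → Via x a v p
      reach {x} = go (inj₁ refl)
        where
        go : ∀ {u v} → u ≡ x ⊎ ∃₂ (λ a p → Via x a u p) → Star _~_ u v →
             v ≡ x ⊎ ∃₂ (λ a p → Via x a v p)
        go h ε = h
        go (inj₁ refl) (e ◅ es) = go (inj₂ (_ , _ , start e)) es
        go (inj₂ (a , p , π)) (e ◅ es) with via-extend π e
        ... | inj₁ eq       = go (inj₁ eq) es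
        ... | inj₂ (q , π′) = go (inj₂ (a , q , π′)) es

      module _ (acyclic : Acyclic) where

        -- The last edge of the first walk is moved to the front of the second until that walk
        -- begins at `x`; a further visit to `x` would then be a repetition.
        via-not-back : ∀ {x b u q L P} → Via x b u q → Reduced (suc L) P →
          P 0 ≡ q → P 1 ≡ u → ∀ i → i ≤ L → P (suc i) ≢ x
        via-not-back (start _) r refl _ i i≤L eq
          with acyclic _ r (suc i) 0 (s≤s i≤L) z≤n eq
        ... | ()
        via-not-back (step π e w≢) r refl refl i i≤L eq =
          via-not-back π (cons (via-edge π) (≢-sym w≢) r) refl refl
            (suc i) (s≤s i≤L) eq

        via-not-closed : ∀ {x a p} → ¬ Via x a x p
        via-not-closed π with via-walk π
        ... | L , P , r , eq , _ , end
          with acyclic _ r 0 (suc L) z≤n ≤-refl (trans eq (sym end))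
        ...   | ()

        -- Walks arriving at `u` from different neighbours could be glued into a reduced walk from
        -- `x` back to `x`; walks arriving from the same neighbour are shortened together. So the
        -- second vertex labels the component of `u` once `x` is removed.
        via-unique : ∀ {x a b u p q} → Via x a u p → Via x b u q → a ≡ b
        via-unique {p = p} {q} π ρ with p ≟ q
        ... | no p≢q with via-walk π
        ...   | L , P , r , refl , refl , end =
          ⊥-elim (via-not-back ρ (cons (via-edge ρ) (≢-sym p≢q) r) refl refl
            (suc L) ≤-refl end)
        via-unique (start _) (start _) | yes refl = refl
        via-unique (step π _ _) (step ρ _ _) | yes refl = via-unique π ρ
        via-unique (start _) (step ρ _ _) | yes refl = ⊥-elim (via-not-closed ρ)
        via-unique (step π _ _) (start _) | yes refl = ⊥-elim (via-not-closed π)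

open Relational

-- Isomorphisms between relations on different vertex types

record _≃_ {A B : Set} (R : Rel A 0ℓ) (S : Rel B 0ℓ) : Set where
  field
    to        : A → B
    from      : B → A
    to∘from   : ∀ b → to (from b) ≡ b
    from∘to   : ∀ a → from (to a) ≡ a
    to-pres   : ∀ {a a′} → R a a′ → S (to a) (to a′)
    from-pres : ∀ {b b′} → S b b′ → R (from b) (from b′)

  to-injective : ∀ {a a′} → to a ≡ to a′ → a ≡ a′
  to-injective eq = trans (sym (from∘to _)) (trans (cong from eq) (from∘to _))

≃-sym : {A B : Set} {R : Rel A 0ℓ} {S : Rel B 0ℓ} → R ≃ S → S ≃ R
≃-sym I = record
  { to = from ; from = to ; to∘from = from∘to ; from∘to = to∘from
  ; to-pres = from-pres ; from-pres = to-pres }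
  where open _≃_ I

≃-trans : {A B C : Set} {R : Rel A 0ℓ} {S : Rel B 0ℓ} {T : Rel C 0ℓ} → R ≃ S → S ≃ T → R ≃ T
≃-trans I J = record
  { to        = J.to ∘ I.to
  ; from      = I.from ∘ J.from
  ; to∘from   = λ c → trans (cong J.to (I.to∘from (J.from c))) (J.to∘from c)
  ; from∘to   = λ a → trans (cong I.from (J.from∘to (I.to a))) (I.from∘to a)
  ; to-pres   = J.to-pres ∘ I.to-pres
  ; from-pres = I.from-pres ∘ J.from-pres
  }
  where
  module I = _≃_ I
  module J = _≃_ J

module _ {A B : Set} {R : Rel A 0ℓ} {S : Rel B 0ℓ} (I : R ≃ S) where
  open _≃_ I

  Pendant-resp : ∀ {y x} → Pendant R y x → Pendant S (to y) (to x)
  Pendant-resp {y} {x} (e , only) = to-pres e , λ w w~x →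
    trans (sym (to∘from w))
      (cong to (only (from w) (subst (R (from w)) (from∘to x) (from-pres w~x))))

  Neck-resp : ∀ {x y z} → Neck R x y z → Neck S (to x) (to y) (to z)
  Neck-resp {x} {y} {z} (pend , z~y , z≢x , deg) =
    Pendant-resp pend , to-pres z~y , z≢x ∘ to-injective ,
    λ u u~y → Sum.map (back u) (back u)
      (deg (from u) (subst (R (from u)) (from∘to y) (from-pres u~y)))
    where
    back : ∀ u {v} → from u ≡ v → u ≡ to v
    back u eq = trans (sym (to∘from u)) (cong to eq)

  Anchored-resp : ∀ {x} → Anchored R x → Anchored S (to x)
  Anchored-resp (y , z , w , neck , pend) =
    to y , to z , to w , Neck-resp neck , Pendant-resp pend

module _ {A B : Set} {R : Rel A 0ℓ} {S : Rel B 0ℓ} (I : R ≃ S) where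
  open _≃_ I

  Loose-resp : ∀ {x} → Loose R x → Loose S (to x)
  Loose-resp {x} ((y , pend) , ¬anch) = (to y , Pendant-resp I pend) ,
    λ anch → ¬anch (subst (Anchored R) (from∘to x) (Anchored-resp (≃-sym I) anch))

  TwinFree-resp : TwinFree R → TwinFree S
  TwinFree-resp tf p q =
    _≃_.to-injective (≃-sym I) (tf (Pendant-resp (≃-sym I) p) (Pendant-resp (≃-sym I) q))

module _ {A B : Set} {R : Rel A 0ℓ} {S : Rel B 0ℓ} where

  -- Reduced walks are sent to reduced walks by a locally injective f, so
  -- acyclicity of the target makes f injective.
  covering-iso :
    DecidableEquality A → Symmetric R → (∀ a a′ → Star R a a′) →
    Symmetric S → Acyclic S → (∀ b b′ → Star S b b′) →
    (a₀ : A) (f : A → B) →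
    (∀ {a a′} → R a a′ → S (f a) (f a′)) →
    (∀ {a b c} → R a b → R a c → f b ≡ f c → b ≡ c) →
    (∀ a {y} → S (f a) y → ∃[ b ] (R a b × f b ≡ y)) →
    R ≃ S
  covering-iso _≟_ R-sym R-conn S-sym acyclic S-conn a₀ f pres linj lsurj = record
    { to = f ; from = λ b → proj₁ (surj b)
    ; to∘from = λ b → proj₂ (surj b)
    ; from∘to = λ a → inj (proj₂ (surj (f a)))
    ; to-pres = pres
    ; from-pres = λ {b} {b′} e → reflect (subst₂ S (sym (proj₂ (surj b))) (sym (proj₂ (surj b′))) e)
    }
    where
    surj-from : ∀ {b b′} → Star S b b′ → ∃ (λ a → f a ≡ b) → ∃ (λ a → f a ≡ b′)
    surj-from ε        h          = h
    surj-from (e ◅ es) (a , refl) with lsurj a e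
    ... | a′ , _ , eq = surj-from es (a′ , eq)

    surj : ∀ b → ∃ (λ a → f a ≡ b)
    surj b = surj-from (S-conn (f a₀) b) (a₀ , refl)

    map-walk : ∀ {L P} → Symmetric R → Reduced R L P → Reduced S L (f ∘ P)
    map-walk R-sym r .adj i i<L = pres (adj r i i<L)
    map-walk R-sym r .nb  i i<L eq =
      nb r i i<L (linj (R-sym (adj r i (ℕₚ.<-trans (ℕₚ.n<1+n i) i<L))) (adj r (suc i) i<L) eq)

    inj : ∀ {a b} → f a ≡ f b → a ≡ b
    inj {a} {b} eq with reach R R-sym _≟_ (R-conn b a)
    ... | inj₁ a≡b = a≡b
    ... | inj₂ (_ , _ , π) with via-walk R R-sym π
    ...   | L , P , r , refl , _ , refl
      with acyclic _ (map-walk R-sym r) 0 (suc L) z≤n ≤-refl eq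
    ...     | ()

    reflect : ∀ {a b} → S (f a) (f b) → R a b
    reflect {a} e with lsurj a e
    ... | b′ , e′ , eq = subst (R a) (inj eq) e′

-- Cycles and acyclicity

module _ {n} (G : Graph n) where
  open Graph G renaming (sym to ~-sym)

  -- By induction the tail is free of repetitions, so only the first vertex can recur. A recurrence
  -- after one or two steps contradicts irreflexivity or reducedness; a later one closes the cycle
  -- that runs from `P 1` to the recurrence.
  ¬Cycle⇒Acyclic : ¬ Cycle G → Acyclic _~_
  ¬Cycle⇒Acyclic nc = go
    where
    open-walk : ∀ {L P} → Reduced _~_ (suc L) P →
      (∀ i j → i ≤ L → j ≤ L → P (suc i) ≡ P (suc j) → i ≡ j) →
      ∀ i → i ≤ L → P 0 ≢ P (suc i)
    open-walk r inj zero          _   eq = irrefl eq (adj r 0 (s≤s z≤n))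
    open-walk r inj (suc zero)    i≤L eq = nb r 0 (s≤s i≤L) eq
    open-walk {L} {P} r inj (suc (suc m)) m≤L eq = nc (m , c ,
      (λ {i} {j} e → toℕ-injective (inj _ _ (bound i) (bound j) e)) ,
      (λ i → subst (λ k → P (suc k) ~ c (suc i)) (sym (toℕ-inject₁ i))
        (adj r (suc (toℕ i)) (s≤s (bound (suc i))))) ,
      subst (_~ P 1) (trans eq (cong (P ∘ suc) (sym (toℕ-fromℕ (2 + m))))) (adj r 0 (s≤s z≤n)))
      where
      c : Fin (3 + m) → Fin n
      c i = P (suc (toℕ i))

      bound : ∀ i → toℕ i ≤ L
      bound i = ≤-trans (s≤s⁻¹ (toℕ<n i)) m≤L

    go : Acyclic _~_
    go L       r zero    zero    _   _   eq = refl
    go (suc L) r zero    (suc j) _   j≤L eq =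
      ⊥-elim (open-walk r (go L (tail _~_ r)) j (s≤s⁻¹ j≤L) eq)
    go (suc L) r (suc i) zero    i≤L _   eq =
      ⊥-elim (open-walk r (go L (tail _~_ r)) i (s≤s⁻¹ i≤L) (sym eq))
    go (suc L) r (suc i) (suc j) i≤L j≤L eq =
      cong suc (go L (tail _~_ r) i j (s≤s⁻¹ i≤L) (s≤s⁻¹ j≤L) eq)

  -- E u v orients the edge from u towards its parent v.  Around a cycle two
  -- consecutive edges cannot both leave their common vertex, so one would
  -- climb, or descend, all the way round.
  parent⇒¬Cycle : (E : Rel (Fin n) 0ℓ) (h : Fin n → ℕ) →
    (∀ {u v} → u ~ v → E u v ⊎ E v u) →
    (∀ {u v w} → E u v → E u w → v ≡ w) →
    (∀ {u v} → E u v → h v < h u) → ¬ Cycle G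
  parent⇒¬Cycle E h orient parent-unique lower (m , c , c-inj , edge , close) =
    [ falling , rising ]′ (orient close)
    where
    last : Fin (3 + m)
    last = fromℕ (2 + m)

    far : ∀ (i : Fin (1 + m)) → c (inject₁ (inject₁ i)) ≢ c (suc (suc i))
    far i eq = ℕₚ.<⇒≢ (s≤s (n≤1+n _))
      (trans (trans (sym (toℕ-inject₁ i)) (sym (toℕ-inject₁ (inject₁ i)))) (cong toℕ (c-inj eq)))

    c₁≢last : c last ≢ c (suc zero)
    c₁≢last eq with c-inj eq
    ... | ()

    c₀≢prev : c zero ≢ c (inject₁ (suc (fromℕ m)))
    c₀≢prev eq with c-inj eq
    ... | ()

    rising : ¬ E (c zero) (c last)
    rising E₀ = ℕₚ.<-asym (lower E₀) (climb (suc (fromℕ m)))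
      where
      up : ∀ i → E (c (suc i)) (c (inject₁ i))
      up = <-weakInduction _
        ([ (λ d → ⊥-elim (c₁≢last (parent-unique E₀ d))) , id ]′ (orient (edge zero)))
        λ i e → [ (λ d → ⊥-elim (far i (parent-unique e d))) , id ]′ (orient (edge (suc i)))

      climb : ∀ i → h (c zero) < h (c (suc i))
      climb = <-weakInduction _ (lower (up zero))
        λ i q → ℕₚ.<-trans q (lower (up (suc i)))

    falling : ¬ E (c last) (c zero)
    falling E₀ = ℕₚ.<-asym (lower E₀) (descend (suc (fromℕ m)))
      where
      down : ∀ i → E (c (inject₁ i)) (c (suc i))
      down = >-weakInduction (λ i → E (c (inject₁ i)) (c (suc i)))
        ([ id , (λ d → ⊥-elim (c₀≢prev (parent-unique E₀ d))) ]′ (orient (edge (suc (fromℕ m)))))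
        λ i e → [ id , (λ d → ⊥-elim (far i (sym (parent-unique e d)))) ]′ (orient (edge (inject₁ i)))

      descend : ∀ i → h (c (suc i)) < h (c zero)
      descend = <-weakInduction (λ i → h (c (suc i)) < h (c zero)) (lower (down zero))
        λ i q → ℕₚ.<-trans (lower (down (suc i))) q

open Equivalence using () renaming (to to ⇒; from to ⇐)

-- Modules and critical vertices of trees

comprehension : ∀ {n} {P : Fin n → Set} → (∀ x → Dec (P x)) → ∃[ S ] (∀ x → x ∈ S ⇔ P x)
comprehension {P = P} P? = tabulate (does ∘ P?) , λ x → mk⇔
  (λ x∈ → sound (P? x) (trans (sym (lookup∘tabulate (does ∘ P?) x)) ([]=⇒lookup x∈)))
  (λ Px → lookup⇒[]= x _ (trans (lookup∘tabulate (does ∘ P?) x) (dec-true (P? x) Px)))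
  where
  sound : ∀ {x} (d : Dec (P x)) → does d ≡ true → P x
  sound (yes p) _ = p

two-elements : ∀ {n} (S : Subset n) → ∣ S ∣ ≡ 2 →
  ∃₂ λ x y → x ≢ y × x ∈ S × y ∈ S × (∀ z → z ∈ S → z ≡ x ⊎ z ≡ y)
two-elements (outside ∷ S) eq with two-elements S eq
... | x , y , x≢y , x∈ , y∈ , only =
  suc x , suc y , x≢y ∘ Finₚ.suc-injective , there x∈ , there y∈ ,
  λ { (suc z) (there z∈) → Sum.map (cong suc) (cong suc) (only z z∈) }
two-elements (inside ∷ S) eq with one-element S (ℕₚ.suc-injective eq)
  where
  no-element : ∀ {n} (S : Subset n) → ∣ S ∣ ≡ 0 → ∀ z → z ∉ S
  no-element (outside ∷ S) eq (suc z) (there z∈) = no-element S eq z z∈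

  one-element : ∀ {n} (S : Subset n) → ∣ S ∣ ≡ 1 → ∃ λ x → x ∈ S × (∀ z → z ∈ S → z ≡ x)
  one-element (outside ∷ S) eq with one-element S eq
  ... | x , x∈ , only = suc x , there x∈ , λ { (suc z) (there z∈) → cong suc (only z z∈) }
  one-element (inside ∷ S) eq = zero , here , λ
    { zero z∈ → refl
    ; (suc z) (there z∈) → contradiction z∈ (no-element S (ℕₚ.suc-injective eq) z) }
... | y , y∈ , only = zero , suc y , (λ ()) , here , there y∈ , λ
  { zero _ → inj₁ refl ; (suc z) (there z∈) → inj₂ (cong suc (only z z∈)) }

∣⁅x⁆∪⁅y⁆∣≡2 : ∀ {n} {x y : Fin n} → x ≢ y → ∣ ⁅ x ⁆ ∪ ⁅ y ⁆ ∣ ≡ 2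
∣⁅x⁆∪⁅y⁆∣≡2 {x = zero}  {zero}  x≢y = contradiction refl x≢y
∣⁅x⁆∪⁅y⁆∣≡2 {x = zero}  {suc y} _   =
  cong suc (trans (cong ∣_∣ (∪-identityˡ ⁅ y ⁆)) (∣⁅x⁆∣≡1 y))
∣⁅x⁆∪⁅y⁆∣≡2 {x = suc x} {zero}  _   =
  cong suc (trans (cong ∣_∣ (∪-identityʳ ⁅ x ⁆)) (∣⁅x⁆∣≡1 x))
∣⁅x⁆∪⁅y⁆∣≡2 {x = suc x} {suc y} x≢y = ∣⁅x⁆∪⁅y⁆∣≡2 (x≢y ∘ cong suc)

crossing : ∀ {A : Set} {R : Rel A 0ℓ} {P : A → Set} → (∀ a → Dec (P a)) →
  ∀ {u v} → Star R u v → P u → ¬ P v → ∃₂ λ a b → R a b × P a × ¬ P b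
crossing P? ε Pu ¬Pv = contradiction Pu ¬Pv
crossing P? {u} (_◅_ {j = w} e es) Pu ¬Pv with P? w
... | yes Pw = crossing P? es Pw ¬Pv
... | no ¬Pw = u , w , e , Pu , ¬Pw

module _ {n} (G : Graph n) where
  open Graph G renaming (sym to ~-sym)

  twins⇒Decomposable : ∀ {z u v} → u ≢ v → Pendant _~_ z u → Pendant _~_ z v → Decomposable G
  twins⇒Decomposable {z} {u} {v} u≢v (z~u , only-u) (z~v , only-v) = M , isModule , nontrivial
    where
    M : Subset n
    M = ⁅ u ⁆ ∪ ⁅ v ⁆

    ∈M⇒ : ∀ {y} → y ∈ M → y ≡ u ⊎ y ≡ v
    ∈M⇒ y∈ = Sum.map (x∈⁅y⁆⇒x≡y u) (x∈⁅y⁆⇒x≡y v) (x∈p∪q⁻ ⁅ u ⁆ ⁅ v ⁆ y∈)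

    u∈M : u ∈ M
    u∈M = x∈p∪q⁺ (inj₁ (x∈⁅x⁆ u))

    v∈M : v ∈ M
    v∈M = x∈p∪q⁺ (inj₂ (x∈⁅x⁆ v))

    isModule : IsModule G M
    isModule x _ with x ≟ z
    ... | yes refl = inj₁ λ y y∈ → [ (λ { refl → z~u }) , (λ { refl → z~v }) ]′ (∈M⇒ y∈)
    ... | no  x≢z  = inj₂ λ y y∈ x~y → x≢z
      ([ (λ { refl → only-u x x~y }) , (λ { refl → only-v x x~y }) ]′ (∈M⇒ y∈))

    nontrivial : ¬ Trivial M
    nontrivial (inj₁ M≡⊥) = ∉⊥ (subst (u ∈_) M≡⊥ u∈M)
    nontrivial (inj₂ (inj₁ (x , M≡x))) = u≢v (trans
      (x∈⁅y⁆⇒x≡y x (subst (u ∈_) M≡x u∈M)) (sym (x∈⁅y⁆⇒x≡y x (subst (v ∈_) M≡x v∈M))))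
    nontrivial (inj₂ (inj₂ M≡⊤)) =
      [ (λ eq → irrefl eq z~u) , (λ eq → irrefl eq z~v) ]′ (∈M⇒ (subst (z ∈_) (sym M≡⊤) ∈⊤))

  Prime⇒TwinFree : Prime G → TwinFree _~_
  Prime⇒TwinFree (_ , triv) {z} {u} {v} p q with u ≟ v
  ... | yes u≡v = u≡v
  ... | no  u≢v with twins⇒Decomposable u≢v p q
  ...   | M , isModule , nontrivial = contradiction (triv M isModule) nontrivial

  module _ (acyclic : Acyclic _~_) where

    triangle-free : ∀ {a b c} → a ~ b → b ~ c → ¬ c ~ a
    triangle-free a~b b~c c~a
      with acyclic 3 (cons _~_ a~b (λ eq → irrefl (sym eq) c~a)
             (cons _~_ b~c (λ eq → irrefl (sym eq) a~b) (single _~_ c~a))) 0 3 z≤n ≤-refl refl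
    ... | ()

    square-free : ∀ {a b c d} → a ≢ c → a ~ b → b ~ c → c ~ d → d ~ a → b ≡ d
    square-free {b = b} {d = d} a≢c a~b b~c c~d d~a with b ≟ d
    ... | yes b≡d = b≡d
    ... | no  b≢d with acyclic 4 (cons _~_ a~b a≢c (cons _~_ b~c b≢d
                     (cons _~_ c~d (≢-sym a≢c) (single _~_ d~a)))) 0 4 z≤n ≤-refl refl
    ...   | ()

    -- By connectivity some edge leaves a proper nonempty module, to `b` say, and `b` is then joined
    -- to the whole module. Once the module has a second vertex, a further neighbour of a module
    -- vertex would create a triangle if it is inside the module and a square if it is outside; so
    -- two module vertices are twins at `b`.
    tree-module-trivial : Connected G → TwinFree _~_ → ∀ M → IsModule G M → Trivial M
    tree-module-trivial conn twin-free M isModule with nonempty? M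
    ... | no empty = inj₁ (Empty-unique empty)
    ... | yes (u , u∈) with any? (λ v → ¬? (v ∈? M))
    ...   | no full = inj₂ (inj₂ (⊆-antisym ⊆⊤
      (λ {v} _ → decidable-stable (v ∈? M) (λ v∉ → full (v , v∉)))))
    ...   | yes (v , v∉) with crossing (_∈? M) (conn u v) u∈ v∉
    ...     | a , b , a~b , a∈ , b∉ with isModule b b∉
    ...       | inj₂ none = contradiction (~-sym a~b) (none a a∈)
    ...       | inj₁ joined with any? (λ a′ → (a′ ∈? M) ×-dec ¬? (a′ ≟ a))
    ...         | no alone = inj₂ (inj₁ (a , ⊆-antisym
      (λ {a′} a′∈ → subst (_∈ ⁅ a ⁆)
        (sym (decidable-stable (a′ ≟ a) (λ a′≢a → alone (a′ , a′∈ , a′≢a)))) (x∈⁅x⁆ a))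
      (λ {x} x∈ → subst (_∈ M) (sym (x∈⁅y⁆⇒x≡y a x∈)) a∈)))
    ...         | yes (a′ , a′∈ , a′≢a) = contradiction
      (twin-free (pendant a∈ a′∈ (≢-sym a′≢a)) (pendant a′∈ a∈ a′≢a)) (≢-sym a′≢a)
      where
      pendant : ∀ {a a′} → a ∈ M → a′ ∈ M → a ≢ a′ → Pendant _~_ b a
      pendant {a} {a′} a∈ a′∈ a≢a′ = joined a a∈ , only
        where
        only : ∀ c → c ~ a → c ≡ b
        only c c~a with c ∈? M
        ... | yes c∈ = contradiction (joined a a∈) (triangle-free c~a′ (~-sym (joined c c∈)))
          where c~a′ = ~-sym c~a
        ... | no  c∉ with isModule c c∉
        ...   | inj₁ all  = square-free a≢a′ (~-sym c~a) (all a′ a′∈) (~-sym (joined a′ a′∈)) (joined a a∈)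
        ...   | inj₂ none = contradiction c~a (none a a∈)

-- Deleting a vertex of a twin-free tree

module _ {n} (G : Graph (suc n)) (conn : Connected G)
         (acyclic : Acyclic (Graph._~_ G)) (twin-free : TwinFree (Graph._~_ G))
         (x : Fin (suc n)) where
  open Graph G renaming (sym to ~-sym)

  private
    G-x : Graph n
    G-x = delete G x

    module G-x = Graph G-x

  restore : ∀ {v} → v ≢ x → ∃[ u ] punchIn x u ≡ v
  restore v≢x = punchOut (≢-sym v≢x) , punchIn-punchOut (≢-sym v≢x)

  delete-acyclic : Acyclic G-x._~_
  delete-acyclic L {P} r i j i≤L j≤L eq = acyclic L
    {punchIn x ∘ P}
    (record { adj = adj r ; nb = λ i i<L → nb r i i<L ∘ punchIn-injective x _ _ })
    i j i≤L j≤L (cong (punchIn x) eq)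

  pendant-delete : ∀ {z u} → Pendant _~_ (punchIn x z) (punchIn x u) → Pendant G-x._~_ z u
  pendant-delete (e , only) = e , λ w w~ → punchIn-injective x _ _ (only _ w~)

  Anchored⇒Critical : Anchored _~_ x → Critical G x
  Anchored⇒Critical (y , z , w , ((y~x , only-x) , z~y , z≢x , deg) , (z~w , only-w))
    with restore {y} (λ { refl → irrefl refl y~x }) | restore {z} z≢x
       | restore {w} (λ { refl → z≢y (only-x z z~w) })
    where
    z≢y : z ≢ y
    z≢y refl = irrefl refl z~y
  ... | y′ , refl | z′ , refl | w′ , refl = twins⇒Decomposable G-x
    (λ { refl → z≢x (sym (only-w x (~-sym y~x))) })
    (z~y , λ u u~y → [ (λ eq → contradiction eq (punchInᵢ≢i x u)) , punchIn-injective x _ _ ]′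
      (deg _ u~y))
    (pendant-delete (z~w , only-w))

  -- Walks are pushed into `G-x` by the retraction that sends the leaf `x` to its only neighbour and
  -- so collapses the edge between them.
  Pendant⇒delete-connected : ∀ {y} → Pendant _~_ y x → Connected G-x
  Pendant⇒delete-connected {y} (y~x , only) u v =
    subst₂ (Star G-x._~_) (retract-punchIn u) (retract-punchIn v) (push (conn (punchIn x u) (punchIn x v)))
    where
    y≢x : y ≢ x
    y≢x refl = irrefl refl y~x

    retract : Fin (suc n) → Fin n
    retract v with v ≟ x
    ... | yes _   = proj₁ (restore y≢x)
    ... | no  v≢x = proj₁ (restore v≢x)

    retract-punchIn : ∀ u → retract (punchIn x u) ≡ u
    retract-punchIn u with punchIn x u ≟ x
    ... | yes eq = contradiction eq (punchInᵢ≢i x u)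
    ... | no neq = punchIn-injective x _ _ (proj₂ (restore neq))

    retract-edge : ∀ {a b} → a ~ b → Star G-x._~_ (retract a) (retract b)
    retract-edge {a} {b} a~b with a ≟ x | b ≟ x
    ... | yes _    | yes _    = ε
    ... | yes refl | no b≢x   = subst (Star G-x._~_ _) (punchIn-injective x _ _
      (trans (proj₂ (restore y≢x)) (trans (sym (only b (~-sym a~b))) (sym (proj₂ (restore b≢x)))))) ε
    ... | no a≢x   | yes refl = subst (Star G-x._~_ _) (punchIn-injective x _ _
      (trans (proj₂ (restore a≢x)) (trans (only a a~b) (sym (proj₂ (restore y≢x)))))) ε
    ... | no a≢x   | no b≢x   =
      subst₂ _~_ (sym (proj₂ (restore a≢x))) (sym (proj₂ (restore b≢x))) a~b ◅ ε

    push : ∀ {a b} → Star _~_ a b → Star G-x._~_ (retract a) (retract b)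
    push ε        = ε
    push (e ◅ es) = retract-edge e ◅◅ push es

  -- A leaf of `G-x` other than `y` is already a leaf of `G`, since `y` alone loses a neighbour. New
  -- twins would therefore involve `y`, and that is precisely an anchoring of `x`.
  Loose⇒delete-twin-free : Loose _~_ x → TwinFree G-x._~_
  Loose⇒delete-twin-free ((y , y~x , only-x) , ¬anch) = go
    where
    lift : ∀ {z u} → punchIn x u ≢ y → Pendant G-x._~_ z u → Pendant _~_ (punchIn x z) (punchIn x u)
    lift {z} {u} u≢y (e , only) = e , λ w w~u → lift′ w w~u (w ≟ x)
      where
      lift′ : ∀ w → w ~ punchIn x u → Dec (w ≡ x) → w ≡ punchIn x z
      lift′ w w~u (yes refl) = contradiction (only-x _ (~-sym w~u)) u≢y
      lift′ w w~u (no w≢x) with restore w≢x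
      ... | w′ , refl = cong (punchIn x) (only w′ w~u)

    anchor : ∀ {z u v} → Pendant G-x._~_ z u → Pendant G-x._~_ z v →
      punchIn x u ≡ y → punchIn x v ≢ y → Anchored _~_ x
    anchor {z} (z~u , only-u) q refl v≢y = y , punchIn x z , _ ,
      ((y~x , only-x) , z~u , punchInᵢ≢i x z , deg) , lift v≢y q
      where
      deg : ∀ w → w ~ y → w ≡ x ⊎ w ≡ punchIn x z
      deg w w~y with w ≟ x
      ... | yes w≡x = inj₁ w≡x
      ... | no w≢x with restore w≢x
      ...   | w′ , refl = inj₂ (cong (punchIn x) (only-u w′ w~y))

    go : TwinFree G-x._~_
    go {z} {u} {v} p q with punchIn x u ≟ y | punchIn x v ≟ y
    ... | yes u≡y | yes v≡y = punchIn-injective x _ _ (trans u≡y (sym v≡y))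
    ... | no u≢y  | no v≢y  = punchIn-injective x _ _ (twin-free (lift u≢y p) (lift v≢y q))
    ... | yes u≡y | no v≢y  = contradiction (anchor p q u≡y v≢y) ¬anch
    ... | no u≢y  | yes v≡y = contradiction (anchor q p v≡y u≢y) ¬anch

  Loose⇒¬Critical : Loose _~_ x → ¬ Critical G x
  Loose⇒¬Critical loose@((y , pend) , _) (M , isModule , nontrivial) = nontrivial
    (tree-module-trivial G-x delete-acyclic (Pendant⇒delete-connected pend)
      (Loose⇒delete-twin-free loose) M isModule)

  -- The component of a in G - x is a module, and so is its complement; they
  -- cannot both be trivial when n is at least three.
  branching⇒Critical : 3 ≤ n → ∀ {a b} → a ~ x → b ~ x → b ≢ a → Critical G x
  branching⇒Critical 3≤n {a} {b} a~x b~x b≢a = decompose (∣ M ∣ ℕₚ.≟ 1)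
    where
    -- Vertices are sorted by the first step of the reduced walk from `x`. By `via-unique` this
    -- label is constant along edges of `G-x`, so no edge joins the fibre of `a` to its complement.
    branch : ∀ u → ∃₂ λ c p → Via _~_ ~-sym x c (punchIn x u) p
    branch u with reach _~_ ~-sym _≟_ (conn x (punchIn x u))
    ... | inj₁ eq  = contradiction eq (punchInᵢ≢i x u)
    ... | inj₂ via = via

    Side : Fin n → Set
    Side u = proj₁ (branch u) ≡ a

    side : ∃[ S ] (∀ u → u ∈ S ⇔ Side u)
    side = comprehension (λ u → proj₁ (branch u) ≟ a)

    M : Subset n
    M = proj₁ side

    branch-unique : ∀ {u c p} → Via _~_ ~-sym x c (punchIn x u) p → proj₁ (branch u) ≡ c
    branch-unique {u} via = via-unique _~_ ~-sym _≟_ acyclic (proj₂ (proj₂ (branch u))) via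

    branch-edge : ∀ {u v} → u G-x.~ v → proj₁ (branch u) ≡ proj₁ (branch v)
    branch-edge {u} {v} u~v with via-extend _~_ ~-sym _≟_ (proj₂ (proj₂ (branch u))) u~v
    ... | inj₁ eq        = contradiction eq (punchInᵢ≢i x v)
    ... | inj₂ (p , via) = sym (branch-unique {v} via)

    M-module : IsModule G-x M
    M-module v v∉ = inj₂ λ u u∈ v~u → v∉ (⇐ (proj₂ side v)
      (trans (branch-edge v~u) (⇒ (proj₂ side u) u∈)))

    ∁M-module : IsModule G-x (∁ M)
    ∁M-module v v∉ = inj₂ λ u u∈ v~u → x∈∁p⇒x∉p u∈ (⇐ (proj₂ side u)
      (trans (sym (branch-edge v~u)) (⇒ (proj₂ side v) (x∉∁p⇒x∈p v∉))))

    near : ∀ {c} → c ~ x → ∃[ c′ ] (punchIn x c′ ≡ c × proj₁ (branch c′) ≡ c)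
    near c~x with restore {_} (λ eq → irrefl eq c~x)
    ... | c′ , refl = c′ , refl , branch-unique {c′} (start (~-sym c~x))

    a∈M : proj₁ (near a~x) ∈ M
    a∈M = ⇐ (proj₂ side _) (proj₂ (proj₂ (near a~x)))

    b∉M : proj₁ (near b~x) ∉ M
    b∉M b∈ = b≢a (trans (sym (proj₂ (proj₂ (near b~x)))) (⇒ (proj₂ side _) b∈))

    nontrivial : ∀ {S : Subset n} {c d} → c ∈ S → d ∉ S → ∣ S ∣ ≢ 1 → ¬ Trivial S
    nontrivial c∈ d∉ size (inj₁ refl)              = ∉⊥ c∈
    nontrivial c∈ d∉ size (inj₂ (inj₁ (e , refl))) = size (∣⁅x⁆∣≡1 e)
    nontrivial c∈ d∉ size (inj₂ (inj₂ refl))       = d∉ ∈⊤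

    decompose : Dec (∣ M ∣ ≡ 1) → Decomposable G-x
    decompose (no size)  = M , M-module , nontrivial a∈M b∉M size
    decompose (yes size) = ∁ M , ∁M-module ,
      nontrivial (x∉p⇒x∈∁p b∉M) (x∈p⇒x∉∁p a∈M)
        (λ eq → ℕₚ.<⇒≢ (ℕₚ.∸-monoˡ-≤ 1 3≤n)
          (sym (trans (cong (n ∸_) (sym size)) (trans (sym (∣∁p∣≡n∸∣p∣ M)) eq))))

  ¬Critical⇒Loose : 3 ≤ n → ¬ Critical G x → Loose _~_ x
  ¬Critical⇒Loose 3≤n ¬crit = pendant , ¬crit ∘ Anchored⇒Critical
    where
    neighbour : 3 ≤ n → ∃[ y ] y ~ x
    neighbour (s≤s _) = first (conn x (punchIn x zero)) refl
      where
      first : ∀ {v} → Star _~_ x v → v ≡ punchIn x zero → ∃[ y ] y ~ x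
      first ε       eq = contradiction (sym eq) (punchInᵢ≢i x zero)
      first (e ◅ _) _  = _ , ~-sym e

    pendant : ∃[ y ] Pendant _~_ y x
    pendant with neighbour 3≤n
    ... | y , y~x with any? (λ b → (b ~? x) ×-dec ¬? (b ≟ y))
    ...   | yes (b , b~x , b≢y) = contradiction (branching⇒Critical 3≤n y~x b~x b≢y) ¬crit
    ...   | no none = y , y~x , λ w w~x →
      decidable-stable (w ≟ y) (λ w≢y → none (w , w~x , w≢y))

-- Two non-critical vertices in terms of loose leaves

ExactlyTwo : {A : Set} → (A → Set) → Set
ExactlyTwo P = ∃₂ λ x y → x ≢ y × P x × P y × (∀ z → P z → z ≡ x ⊎ z ≡ y)

module _ {n} (G : Graph n) (tree : IsTree G) (5≤n : 5 ≤ n) where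
  open Graph G hiding (sym)

  private
    acyclic : Acyclic _~_
    acyclic = ¬Cycle⇒Acyclic G (proj₂ tree)

  Loose⇔¬Critical : TwinFree _~_ → ∀ x → Loose _~_ x ⇔ (¬ Critical G x)
  Loose⇔¬Critical = go G (proj₁ tree) acyclic 5≤n
    where
    go : ∀ {n} (G : Graph n) → Connected G → Acyclic (Graph._~_ G) → 5 ≤ n →
      TwinFree (Graph._~_ G) → ∀ x → Loose (Graph._~_ G) x ⇔ (¬ Critical G x)
    go {suc n} G conn acyclic 5≤n tf x = mk⇔
      (Loose⇒¬Critical G conn acyclic tf x)
      (¬Critical⇒Loose G conn acyclic tf x (≤-trans (s≤s (s≤s (s≤s z≤n))) (s≤s⁻¹ 5≤n)))

  -- Trades modules and vertex deletion for conditions on the edge relation alone, which can be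
  -- carried along `_≃_`.
  MinusCritical⇔ : MinusCritical 2 G ⇔ (TwinFree _~_ × ExactlyTwo (Loose _~_))
  MinusCritical⇔ = mk⇔ ⇒′ ⇐′
    where
    ⇒′ : MinusCritical 2 G → TwinFree _~_ × ExactlyTwo (Loose _~_)
    ⇒′ (prime , S , size , S⇔) with two-elements S size
    ... | x , y , x≢y , x∈ , y∈ , only = tf , x , y , x≢y , loose x∈ , loose y∈ ,
      λ z l → only z (⇐ (S⇔ z) (⇒ (Loose⇔¬Critical tf z) l))
      where
      tf : TwinFree _~_
      tf = Prime⇒TwinFree G prime

      loose : ∀ {z} → z ∈ S → Loose _~_ z
      loose {z} z∈ = ⇐ (Loose⇔¬Critical tf z) (⇒ (S⇔ z) z∈)

    ⇐′ : TwinFree _~_ × ExactlyTwo (Loose _~_) → MinusCritical 2 G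
    ⇐′ (tf , x , y , x≢y , lx , ly , only) =
      (≤-trans (n≤1+n 4) 5≤n , tree-module-trivial G acyclic (proj₁ tree) tf) ,
      ⁅ x ⁆ ∪ ⁅ y ⁆ , ∣⁅x⁆∪⁅y⁆∣≡2 x≢y , λ z → mk⇔
        (λ z∈ → ⇒ (Loose⇔¬Critical tf z)
          ([ (λ z∈ → subst (Loose _~_) (sym (x∈⁅y⁆⇒x≡y x z∈)) lx)
           , (λ z∈ → subst (Loose _~_) (sym (x∈⁅y⁆⇒x≡y y z∈)) ly) ]′ (x∈p∪q⁻ ⁅ x ⁆ ⁅ y ⁆ z∈)))
        (λ nc → x∈p∪q⁺ (Sum.map
          (λ eq → subst (_∈ ⁅ x ⁆) (sym eq) (x∈⁅x⁆ x))
          (λ eq → subst (_∈ ⁅ y ⁆) (sym eq) (x∈⁅x⁆ y))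
          (only z (⇐ (Loose⇔¬Critical tf z) nc))))

-- Barbells

data Side : Set where
  left right : Side

-- The hubs are the neighbours of the two ends of the path. `hub` is a successor by definition, so
-- that the vertex below a hub is at hand without a case split on the side.
pre hub : ℕ → Side → ℕ
pre c left  = 0
pre c right = 1 + c
hub c s = suc (pre c s)

-- `c` is the number of path vertices strictly between the hubs; a leg contributes its middle vertex
-- and its tip.
size : (Side → ℕ) → ℕ → ℕ
size k c = 4 + c + ((k left + k right) + (k left + k right))

module Barbell (k : Side → ℕ) (c : ℕ) where

  -- The path pt 0, …, pt (c + 3) with k left legs of length two hanging from
  -- pt 1 and k right ones from pt (c + 2).
  data Vertex : Set where
    pt  : Fin (4 + c) → Vertex
    mid : ∀ s → Fin (k s) → Vertex
    tip : ∀ s → Fin (k s) → Vertex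

  infix 4 _⟶_ _∼_

  -- Every edge points towards `pt zero`. Parents are then unique, as `parent⇒¬Cycle` requires.
  data _⟶_ : Rel Vertex 0ℓ where
    path : ∀ {i j} → toℕ i ≡ suc (toℕ j) → pt i ⟶ pt j
    limb : ∀ {s a i} → toℕ i ≡ hub c s → mid s a ⟶ pt i
    toe  : ∀ {s a} → tip s a ⟶ mid s a

  _∼_ : Rel Vertex 0ℓ
  u ∼ v = u ⟶ v ⊎ v ⟶ u

  ∼-sym : Symmetric _∼_
  ∼-sym = Sum.swap

  -- Not a distance: the legs at both hubs get the same two values, chosen only to lie above the
  -- whole path.
  height : Vertex → ℕ
  height (pt i)    = toℕ i
  height (mid _ _) = 4 + c
  height (tip _ _) = 5 + c

  ⟶-lower : ∀ {u v} → u ⟶ v → height v < height u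
  ⟶-lower (path eq)          = ℕₚ.≤-reflexive (sym eq)
  ⟶-lower (limb {i = i} _)   = toℕ<n i
  ⟶-lower toe                = ≤-refl

  ⟶-unique : ∀ {u v w} → u ⟶ v → u ⟶ w → v ≡ w
  ⟶-unique (path p) (path q) = cong pt (toℕ-injective (ℕₚ.suc-injective (trans (sym p) q)))
  ⟶-unique (limb p) (limb q) = cong pt (toℕ-injective (trans p (sym q)))
  ⟶-unique toe      toe      = refl

  ∼-irrefl : Irreflexive _≡_ _∼_
  ∼-irrefl refl = [ loop , loop ]′
    where
    loop : ∀ {u} → ¬ (u ⟶ u)
    loop e = ℕₚ.<-irrefl refl (⟶-lower e)

  vertex↔ : Fin (size k c) ↔ Vertex
  vertex↔ = ↔-trans (↔-trans +↔⊎ (↔-refl ⊎-↔ ↔-trans +↔⊎ (+↔⊎ ⊎-↔ +↔⊎))) (mk↔ₛ′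
    (λ { (inj₁ i)               → pt i
       ; (inj₂ (inj₁ (inj₁ a))) → mid left a
       ; (inj₂ (inj₁ (inj₂ a))) → mid right a
       ; (inj₂ (inj₂ (inj₁ a))) → tip left a
       ; (inj₂ (inj₂ (inj₂ a))) → tip right a })
    (λ { (pt i)        → inj₁ i
       ; (mid left a)  → inj₂ (inj₁ (inj₁ a))
       ; (mid right a) → inj₂ (inj₁ (inj₂ a))
       ; (tip left a)  → inj₂ (inj₂ (inj₁ a))
       ; (tip right a) → inj₂ (inj₂ (inj₂ a)) })
    (λ { (pt i) → refl ; (mid left a) → refl ; (mid right a) → refl
       ; (tip left a) → refl ; (tip right a) → refl })
    (λ { (inj₁ i) → refl ; (inj₂ (inj₁ (inj₁ a))) → refl ; (inj₂ (inj₁ (inj₂ a))) → refl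
       ; (inj₂ (inj₂ (inj₁ a))) → refl ; (inj₂ (inj₂ (inj₂ a))) → refl }))

  _≟ᵛ_ : DecidableEquality Vertex
  _≟ᵛ_ = via-injection (mk↣ {to = Inverse.from vertex↔} inj) _≟_
    where
    inj : ∀ {u v} → Inverse.from vertex↔ u ≡ Inverse.from vertex↔ v → u ≡ v
    inj eq = trans (sym (Inverse.strictlyInverseˡ vertex↔ _))
      (trans (cong (Inverse.to vertex↔) eq) (Inverse.strictlyInverseˡ vertex↔ _))

  _⟶?_ : Decidable _⟶_
  pt i    ⟶? pt j    = map′ path (λ { (path eq) → eq }) (toℕ i ℕₚ.≟ suc (toℕ j))
  mid s a ⟶? pt i    = map′ limb (λ { (limb eq) → eq }) (toℕ i ℕₚ.≟ hub c s)
  tip s a ⟶? mid t b = map′ (λ { refl → toe }) (λ { toe → refl }) (mid s a ≟ᵛ mid t b)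
  pt _    ⟶? mid _ _ = no λ ()
  pt _    ⟶? tip _ _ = no λ ()
  mid _ _ ⟶? mid _ _ = no λ ()
  mid _ _ ⟶? tip _ _ = no λ ()
  tip _ _ ⟶? pt _    = no λ ()
  tip _ _ ⟶? tip _ _ = no λ ()

  _∼?_ : Decidable _∼_
  u ∼? v = (u ⟶? v) ⊎-dec (v ⟶? u)

  point : ∀ m → m < 4 + c → ∃[ i ] toℕ i ≡ m
  point m m< = fromℕ< m< , toℕ-fromℕ< m<

  hub< : ∀ s → hub c s < 4 + c
  hub< left  = s≤s (s≤s z≤n)
  hub< right = s≤s (s≤s (s≤s (n≤1+n c)))

  root : Vertex
  root = pt zero

  pt-to-root : ∀ i → Star _∼_ (pt i) root
  pt-to-root = <-weakInduction (λ i → Star _∼_ (pt i) root) ε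
    λ i rest → inj₁ (path (cong suc (sym (toℕ-inject₁ i)))) ◅ rest

  to-root : ∀ u → Star _∼_ u root
  to-root (pt i)    = pt-to-root i
  to-root (mid s a) = inj₁ (limb (proj₂ (point (hub c s) (hub< s)))) ◅ pt-to-root _
  to-root (tip s a) = inj₁ toe ◅ inj₁ (limb (proj₂ (point (hub c s) (hub< s)))) ◅ pt-to-root _

  ∼-connected : ∀ u v → Star _∼_ u v
  ∼-connected u v = to-root u ◅◅ Star.reverse ∼-sym (to-root v)

  pt-injective : ∀ {i j} → pt i ≡ pt j → i ≡ j
  pt-injective refl = refl

  -- The leaves with their neighbours, listed outright. Positions are pinned down by equations on
  -- `toℕ`, so that matching never meets `fromℕ` or `inject₁` in an index.
  data LeafEdge : Rel Vertex 0ℓ where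
    first : ∀ {i j} → toℕ i ≡ 0 → toℕ j ≡ 1 → LeafEdge (pt j) (pt i)
    last  : ∀ {i j} → toℕ i ≡ 3 + c → toℕ j ≡ 2 + c → LeafEdge (pt j) (pt i)
    toe   : ∀ {s a} → LeafEdge (mid s a) (tip s a)

  hub≢3+c : ∀ s → hub c s ≢ 3 + c
  hub≢3+c left  ()
  hub≢3+c right eq = ℕₚ.<⇒≢ ≤-refl eq

  LeafEdge⇒Pendant : ∀ {y x} → LeafEdge y x → Pendant _∼_ y x
  LeafEdge⇒Pendant (first i≡0 j≡1) = inj₁ (path (trans j≡1 (cong suc (sym i≡0)))) , λ
    { _ (inj₁ (path eq)) → cong pt (toℕ-injective (trans eq (trans (cong suc i≡0) (sym j≡1))))
    ; _ (inj₁ (limb {s = s} eq)) → contradiction (trans (sym eq) i≡0) λ ()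
    ; _ (inj₂ (path eq)) → contradiction (trans (sym eq) i≡0) λ () }
  LeafEdge⇒Pendant (last i≡3+c j≡2+c) = inj₂ (path (trans i≡3+c (cong suc (sym j≡2+c)))) , λ
    { _ (inj₁ (path {i = j} eq)) →
        contradiction (trans eq (cong suc i≡3+c)) (ℕₚ.<⇒≢ (toℕ<n j))
    ; _ (inj₁ (limb {s = s} eq)) → contradiction (trans (sym eq) i≡3+c) (hub≢3+c s)
    ; _ (inj₂ (path eq)) → cong pt (toℕ-injective
        (ℕₚ.suc-injective (trans (sym eq) (trans i≡3+c (cong suc (sym j≡2+c)))))) }
  LeafEdge⇒Pendant toe = inj₂ toe , λ { _ (inj₂ toe) → refl }

  Pendant⇒LeafEdge : ∀ {y x} → Pendant _∼_ y x → LeafEdge y x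
  Pendant⇒LeafEdge {x = pt i} (y∼x , only) with toℕ i ℕₚ.≟ 0 | toℕ i ℕₚ.≟ 3 + c
  ... | yes i≡0 | _ = start-edge y∼x
    where
    start-edge : ∀ {y} → y ∼ pt i → LeafEdge y (pt i)
    start-edge (inj₁ (path eq))         = first i≡0 (trans eq (cong suc i≡0))
    start-edge (inj₁ (limb {s = s} eq)) = contradiction (trans (sym eq) i≡0) λ ()
    start-edge (inj₂ (path eq))         = contradiction (trans (sym eq) i≡0) λ ()
  ... | no _ | yes i≡3+c = end-edge y∼x
    where
    end-edge : ∀ {y} → y ∼ pt i → LeafEdge y (pt i)
    end-edge (inj₁ (path {i = j} eq))   =
      contradiction (trans eq (cong suc i≡3+c)) (ℕₚ.<⇒≢ (toℕ<n j))
    end-edge (inj₁ (limb {s = s} eq))   = contradiction (trans (sym eq) i≡3+c) (hub≢3+c s)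
    end-edge (inj₂ (path eq))           = last i≡3+c (ℕₚ.suc-injective (trans (sym eq) i≡3+c))
  Pendant⇒LeafEdge {x = pt zero} _ | no i≢0 | no _ = contradiction refl i≢0
  -- An inner path vertex has a path neighbour on either side, and these differ.
  Pendant⇒LeafEdge {x = pt i@(suc i′)} (y∼x , only) | no _ | no i≢3+c = contradiction
    (trans (only (pt (proj₁ above)) (inj₁ (path (proj₂ above))))
      (sym (only (pt (inject₁ i′)) (inj₂ (path (cong suc (sym (toℕ-inject₁ i′))))))))
    λ { eq → ℕₚ.<⇒≢ (s≤s (n≤1+n _)) (trans (sym (toℕ-inject₁ i′))
      (trans (cong toℕ (sym (pt-injective eq))) (proj₂ above))) }
    where
    above : ∃[ j ] toℕ j ≡ suc (toℕ i)
    above = point (suc (toℕ i)) (s≤s (ℕₚ.≤∧≢⇒< (s≤s⁻¹ (toℕ<n i)) i≢3+c))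
  Pendant⇒LeafEdge {x = mid s a} (_ , only) = contradiction
    (trans (only _ (inj₁ toe)) (sym (only _ (inj₂ (limb (proj₂ (point (hub c s) (hub< s)))))))) λ ()
  Pendant⇒LeafEdge {x = tip s a} (inj₂ toe , _) = toe

  ∼-twin-free : TwinFree _∼_
  ∼-twin-free p q = same (Pendant⇒LeafEdge p) (Pendant⇒LeafEdge q)
    where
    same : ∀ {z u v} → LeafEdge z u → LeafEdge z v → u ≡ v
    same (first i≡0 _)  (first j≡0 _)  = cong pt (toℕ-injective (trans i≡0 (sym j≡0)))
    same (first _ z≡1)  (last _ z≡2+c) = contradiction (trans (sym z≡1) z≡2+c) λ ()
    same (last _ z≡2+c) (first _ z≡1)  = contradiction (trans (sym z≡1) z≡2+c) λ ()
    same (last i≡ _)    (last j≡ _)    = cong pt (toℕ-injective (trans i≡ (sym j≡)))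
    same toe            toe            = refl

  end : Vertex
  end = pt (fromℕ (3 + c))

  root≢end : root ≢ end
  root≢end ()

  root-pendant : Pendant _∼_ (pt (suc zero)) root
  root-pendant = LeafEdge⇒Pendant (first refl refl)

  before-end : Vertex
  before-end = pt (inject₁ (fromℕ (2 + c)))

  end-pendant : Pendant _∼_ before-end end
  end-pendant = LeafEdge⇒Pendant
    (last (toℕ-fromℕ (3 + c)) (trans (toℕ-inject₁ _) (toℕ-fromℕ (2 + c))))

  -- The tip of a leg is never loose: its hub carries an end of the path as a leaf, and this anchors
  -- the tip.
  Loose⇒root⊎end : ∀ x → Loose _∼_ x → x ≡ root ⊎ x ≡ end
  Loose⇒root⊎end x ((y , pend) , ¬anch) with Pendant⇒LeafEdge pend
  ... | first i≡0 _  = inj₁ (cong pt (toℕ-injective i≡0))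
  ... | last i≡ _    = inj₂ (cong pt (toℕ-injective (trans i≡ (sym (toℕ-fromℕ (3 + c))))))
  ... | toe {s} {a} with point (hub c s) (hub< s)
  ...   | z , z≡ = contradiction
    (mid s a , pt z , proj₁ (end-at s z≡) ,
      (pend , inj₂ (limb z≡) , (λ ()) , λ
        { _ (inj₁ toe)       → inj₁ refl
        ; _ (inj₂ (limb eq)) → inj₂ (cong pt (toℕ-injective (trans eq (sym z≡)))) }) ,
      proj₂ (end-at s z≡))
    ¬anch
    where
    end-at : ∀ s {z} → toℕ z ≡ hub c s → ∃[ w ] Pendant _∼_ (pt z) w
    end-at left  eq = root , LeafEdge⇒Pendant (first refl eq)
    end-at right eq = end , LeafEdge⇒Pendant (last (toℕ-fromℕ (3 + c)) eq)

  -- Adjacent hubs are harmless only if both carry legs. A bare hub would have degree two while its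
  -- other neighbour carries the opposite end as a leaf, so its own end would be anchored.
  Wide : Set
  Wide = 1 ≤ c ⊎ (∀ s → 1 ≤ k s)

  first-mid : ∀ s → 1 ≤ k s → Fin (k s)
  first-mid s 1≤ = fromℕ< 1≤

  root-loose : Wide → Loose _∼_ root
  root-loose wide = (_ , root-pendant) , ¬anchored
    where
    ¬anchored : ¬ Anchored _∼_ root
    ¬anchored (y , z , w , (pend , _ , _ , deg) , pend′)
      with proj₂ pend (pt (suc zero)) (proj₁ root-pendant)
    ... | refl with deg (pt (suc (suc zero))) (inj₁ (path refl))
    ...   | inj₂ refl = clash wide (Pendant⇒LeafEdge pend′)
      where
      clash : Wide → ¬ LeafEdge (pt (suc (suc zero))) w
      clash (inj₁ 1≤c) (last _ 2≡2+c) =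
        contradiction (ℕₚ.suc-injective (ℕₚ.suc-injective 2≡2+c)) (ℕₚ.<⇒≢ 1≤c)
      clash (inj₂ 1≤k) _ = [ (λ ()) , (λ ()) ]′ (deg (mid left (first-mid left (1≤k left))) (inj₁ (limb refl)))

  end-loose : Wide → Loose _∼_ end
  end-loose wide = (_ , end-pendant) , ¬anchored
    where
    j : Fin (4 + c)
    j = proj₁ (point (1 + c) (s≤s (s≤s (≤-trans (n≤1+n c) (n≤1+n _)))))

    j≡ : toℕ j ≡ 1 + c
    j≡ = proj₂ (point (1 + c) (s≤s (s≤s (≤-trans (n≤1+n c) (n≤1+n _)))))

    before-end≡ : toℕ (inject₁ (fromℕ (2 + c))) ≡ 2 + c
    before-end≡ = trans (toℕ-inject₁ _) (toℕ-fromℕ (2 + c))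

    ¬anchored : ¬ Anchored _∼_ end
    ¬anchored (y , z , w , (pend , _ , _ , deg) , pend′)
      with proj₂ pend before-end (proj₁ end-pendant)
    ... | refl with deg (pt j) (inj₂ (path (trans before-end≡ (cong suc (sym j≡)))))
    ...   | inj₁ eq = ℕₚ.<⇒≢ (n≤1+n _)
      (trans (sym j≡) (trans (cong toℕ (pt-injective eq)) (toℕ-fromℕ (3 + c))))
    ...   | inj₂ refl = clash wide (Pendant⇒LeafEdge pend′)
      where
      clash : Wide → ¬ LeafEdge (pt j) w
      clash _          (last _ j≡2+c) = ℕₚ.<⇒≢ ≤-refl (trans (sym j≡) j≡2+c)
      clash (inj₁ 1≤c) (first _ j≡1) =
        contradiction (ℕₚ.suc-injective (trans (sym j≡1) j≡)) (ℕₚ.<⇒≢ 1≤c)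
      clash (inj₂ 1≤k) _ = [ (λ ()) , (λ ()) ]′
        (deg (mid right (first-mid right (1≤k right))) (inj₁ (limb before-end≡)))

  endpoint : Side → Vertex
  endpoint left  = root
  endpoint right = end

  endpoint-loose : Wide → ∀ s → Loose _∼_ (endpoint s)
  endpoint-loose wide left  = root-loose wide
  endpoint-loose wide right = end-loose wide

  Loose⇒endpoint : ∀ {x} → Loose _∼_ x → ∃[ s ] x ≡ endpoint s
  Loose⇒endpoint l = [ (left ,_) , (right ,_) ]′ (Loose⇒root⊎end _ l)

  exactly-two-loose : Wide → ExactlyTwo (Loose _∼_)
  exactly-two-loose wide =
    root , end , root≢end , root-loose wide , end-loose wide , Loose⇒root⊎end

  hub-vertex : ∀ s → ∃[ i ] (toℕ i ≡ hub c s × Pendant _∼_ (pt i) (endpoint s))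
  hub-vertex left  = suc zero , refl , root-pendant
  hub-vertex right = _ , trans (toℕ-inject₁ _) (toℕ-fromℕ (2 + c)) , end-pendant

  hub-injective : ∀ {s t} → hub c s ≡ hub c t → s ≡ t
  hub-injective {left}  {left}  _ = refl
  hub-injective {right} {right} _ = refl

  below-hub : ∀ s → Σ (Fin (4 + c)) λ j → toℕ j ≡ pre c s
  below-hub s = point (pre c s) (ℕₚ.<-trans ≤-refl (hub< s))

  above-hub : ∀ s → Σ (Fin (4 + c)) λ j → toℕ j ≡ suc (hub c s)
  above-hub left  = point 2 (s≤s (s≤s (s≤s z≤n)))
  above-hub right = point (3 + c) ≤-refl

  module _ (s : Side) {i : Fin (4 + c)} (i≡ : toℕ i ≡ hub c s) where

    -- The hub has degree `2 + k s`. Two injections, `spoke` and `spoke-index`, are all it takes to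
    -- compare degrees across an isomorphism.
    spoke : Fin (2 + k s) → ∃[ v ] v ∼ pt i
    spoke zero          = pt (proj₁ (below-hub s)) , inj₂ (path (trans i≡ (cong suc (sym (proj₂ (below-hub s))))))
    spoke (suc zero)    = pt (proj₁ (above-hub s)) , inj₁ (path (trans (proj₂ (above-hub s)) (cong suc (sym i≡))))
    spoke (suc (suc a)) = mid s a , inj₁ (limb i≡)

    below≢above : proj₁ (below-hub s) ≢ proj₁ (above-hub s)
    below≢above eq = ℕₚ.<⇒≢ (ℕₚ.m≤n+m _ 1) (trans (sym (proj₂ (below-hub s)))
      (trans (cong toℕ eq) (proj₂ (above-hub s))))

    spoke-injective : ∀ {a b} → proj₁ (spoke a) ≡ proj₁ (spoke b) → a ≡ b
    spoke-injective {zero}        {zero}        _    = refl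
    spoke-injective {suc zero}    {suc zero}    _    = refl
    spoke-injective {suc (suc _)} {suc (suc _)} refl = refl
    spoke-injective {zero}        {suc zero}    eq   = contradiction (pt-injective eq) below≢above
    spoke-injective {suc zero}    {zero}        eq   =
      contradiction (sym (pt-injective eq)) below≢above

    mid-at : ∀ t (a : Fin (k t)) → hub c t ≡ hub c s → Σ (Fin (k s)) λ b → mid t a ≡ mid s b
    mid-at t a eq with hub-injective {t} {s} eq
    ... | refl = a , refl

    spoke-index : ∀ {v} → v ∼ pt i → Fin (2 + k s)
    spoke-index (inj₂ (path _)) = zero
    spoke-index (inj₁ (path _)) = suc zero
    spoke-index (inj₁ (limb {t} {a} eq)) = suc (suc (proj₁ (mid-at t a (trans (sym eq) i≡))))

    spoke-index-injective : ∀ {v w} (e : v ∼ pt i) (f : w ∼ pt i) →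
      spoke-index e ≡ spoke-index f → v ≡ w
    spoke-index-injective (inj₂ (path p)) (inj₂ (path q)) _ =
      cong pt (toℕ-injective (ℕₚ.suc-injective (trans (sym p) q)))
    spoke-index-injective (inj₁ (path p)) (inj₁ (path q)) _ =
      cong pt (toℕ-injective (trans p (sym q)))
    spoke-index-injective (inj₁ (limb {t} {a} p)) (inj₁ (limb {u} {b} q)) eq =
      trans (proj₂ (mid-at t a (trans (sym p) i≡))) (trans
        (cong (mid s) (Finₚ.suc-injective (Finₚ.suc-injective eq))) (sym (proj₂ (mid-at u b (trans (sym q) i≡)))))
    spoke-index-injective (inj₂ (path _)) (inj₁ (path _)) ()
    spoke-index-injective (inj₁ (path _)) (inj₂ (path _)) ()
    spoke-index-injective (inj₂ (path _)) (inj₁ (limb _)) ()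
    spoke-index-injective (inj₁ (limb _)) (inj₂ (path _)) ()
    spoke-index-injective (inj₁ (path _)) (inj₁ (limb _)) ()
    spoke-index-injective (inj₁ (limb _)) (inj₁ (path _)) ()

  module _ {n} (n≡ : n ≡ size k c) where

    private
      e : Fin n ↔ Vertex
      e = subst (λ m → Fin m ↔ Vertex) (sym n≡) vertex↔

    open Inverse e using (to; from; strictlyInverseˡ; strictlyInverseʳ)

    graph : Graph n
    graph = record
      { _~_    = λ u v → to u ∼ to v
      ; _~?_   = λ u v → to u ∼? to v
      ; sym    = ∼-sym
      ; irrefl = ∼-irrefl ∘ cong to
      }

    graph-iso : _∼_ ≃ Graph._~_ graph
    graph-iso = record
      { to        = from
      ; from      = to
      ; to∘from   = strictlyInverseʳ
      ; from∘to   = strictlyInverseˡ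
      ; to-pres   = subst₂ _∼_ (sym (strictlyInverseˡ _)) (sym (strictlyInverseˡ _))
      ; from-pres = id
      }

    graph-tree : IsTree graph
    graph-tree =
      (λ u v → subst₂ (Star _) (strictlyInverseʳ u) (strictlyInverseʳ v)
        (Star.gmap from (_≃_.to-pres graph-iso) (∼-connected (to u) (to v)))) ,
      parent⇒¬Cycle graph (λ u v → to u ⟶ to v) (height ∘ to) id
        (λ p q → _≃_.to-injective (≃-sym graph-iso) (⟶-unique p q)) ⟶-lower

    ExactlyTwo-resp : ExactlyTwo (Loose _∼_) → ExactlyTwo (Loose (Graph._~_ graph))
    ExactlyTwo-resp (x , y , x≢y , lx , ly , only) =
      from x , from y , x≢y ∘ _≃_.to-injective graph-iso ,
      Loose-resp graph-iso lx , Loose-resp graph-iso ly ,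
      λ z lz → Sum.map (back z) (back z) (only (to z) (Loose-resp (≃-sym graph-iso) lz))
      where
      back : ∀ z {x} → to z ≡ x → z ≡ from x
      back z eq = trans (sym (strictlyInverseʳ z)) (cong from eq)

    graph-minus-critical : 5 ≤ n → Wide → MinusCritical 2 graph
    graph-minus-critical 5≤n wide = Equivalence.from (MinusCritical⇔ graph graph-tree 5≤n)
      (TwinFree-resp graph-iso ∼-twin-free , ExactlyTwo-resp (exactly-two-loose wide))

-- Recovering the numbers of legs

module _ {k k′ : Side → ℕ} {c c′ : ℕ} where
  private
    module B  = Barbell k c
    module B′ = Barbell k′ c′

  -- The only neighbour of an end is its hub, so the hub goes to the hub. Its neighbours are mapped
  -- injectively to neighbours, and the summand 2 cancels from the degrees.
  legs-≤ : (I : B._∼_ ≃ B′._∼_) → ∀ {s s′} →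
    _≃_.to I (B.endpoint s) ≡ B′.endpoint s′ → k s ≤ k′ s′
  legs-≤ I {s} {s′} eq = go (B.hub-vertex s) (B′.hub-vertex s′)
    where
    go : (∃[ i ] (toℕ i ≡ hub c s × Pendant B._∼_ (B.pt i) (B.endpoint s))) →
         (∃[ i ] (toℕ i ≡ hub c′ s′ × Pendant B′._∼_ (B′.pt i) (B′.endpoint s′))) → k s ≤ k′ s′
    go (i , i≡ , pend) (i′ , i′≡ , pend′) =
      s≤s⁻¹ (s≤s⁻¹ (Finₚ.injective⇒≤ {f = λ a → B′.spoke-index s′ i′≡ (image a)}
        λ {a} {b} → B.spoke-injective s i≡ ∘ _≃_.to-injective I ∘
          B′.spoke-index-injective s′ i′≡ (image a) (image b)))
      where
      hub↦ : _≃_.to I (B.pt i) ≡ B′.pt i′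
      hub↦ = proj₂ pend′ _ (subst (_≃_.to I (B.pt i) B′.∼_) eq (proj₁ (Pendant-resp I pend)))

      image : ∀ a → _≃_.to I (proj₁ (B.spoke s i≡ a)) B′.∼ B′.pt i′
      image a = subst (_≃_.to I (proj₁ (B.spoke s i≡ a)) B′.∼_) hub↦
        (_≃_.to-pres I (proj₂ (B.spoke s i≡ a)))

module _ {k k′ : Side → ℕ} {c c′ : ℕ} where
  private
    module B  = Barbell k c
    module B′ = Barbell k′ c′

  -- The ends are the loose vertices, so an isomorphism matches them up. If it exchanges left and
  -- right, the orderings on the two sides force all four numbers to be equal.
  legs-unique : B.Wide → k left ≤ k right → k′ left ≤ k′ right → B._∼_ ≃ B′._∼_ →
    k left ≡ k′ left × k right ≡ k′ right
  legs-unique wide l≤r l′≤r′ I = combine (match left) (match right)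
    where
    Match : Side → Set
    Match s = ∃[ s′ ] (_≃_.to I (B.endpoint s) ≡ B′.endpoint s′ × k s ≡ k′ s′)

    match : ∀ s → Match s
    match s = pair (B′.Loose⇒endpoint (Loose-resp I (B.endpoint-loose wide s)))
      where
      pair : ∃[ s′ ] (_≃_.to I (B.endpoint s) ≡ B′.endpoint s′) → Match s
      pair (s′ , eq) = s′ , eq , ℕₚ.≤-antisym (legs-≤ I eq)
        (legs-≤ (≃-sym I) (trans (cong (_≃_.from I) (sym eq)) (_≃_.from∘to I (B.endpoint s))))

    collide : ∀ {s} → _≃_.to I B.root ≡ B′.endpoint s → _≃_.to I B.end ≢ B′.endpoint s
    collide p q = B.root≢end (_≃_.to-injective I (trans p (sym q)))

    combine : Match left → Match right → k left ≡ k′ left × k right ≡ k′ right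
    combine (left  , _ , p) (right , _ , q) = p , q
    combine (right , _ , p) (left  , _ , q) =
      ℕₚ.≤-antisym (≤-trans l≤r (ℕₚ.≤-reflexive q)) (≤-trans l′≤r′ (ℕₚ.≤-reflexive (sym p))) ,
      ℕₚ.≤-antisym (≤-trans (ℕₚ.≤-reflexive q) l′≤r′) (≤-trans (ℕₚ.≤-reflexive (sym p)) l≤r)
    combine (left  , p , _) (left  , q , _) = contradiction q (collide {left} p)
    combine (right , p , _) (right , q , _) = contradiction q (collide {right} p)

-- Branches off the path between the loose leaves

search : ∀ {n} {A B : Fin n → Set} → (∀ i → A i ⊎ B i) → (∀ i → A i) ⊎ ∃ B
search {zero}  h = inj₁ λ ()
search {suc n} h with h zero | search (h ∘ suc)
... | inj₂ b | _             = inj₂ (zero , b)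
... | inj₁ a | inj₁ as       = inj₁ λ { zero → a ; (suc i) → as i }
... | inj₁ _ | inj₂ (i , b)  = inj₂ (suc i , b)

third-vertex : ∀ {n} → 3 ≤ n → (a b : Fin n) → ∃[ c ] (c ≢ a × c ≢ b)
third-vertex {n} 3≤n a b with any? (λ c → ¬? (c ≟ a) ×-dec ¬? (c ≟ b))
... | yes found = found
... | no none   = contradiction (injective⇒≤ {f = code} code-injective) (ℕₚ.<⇒≱ 3≤n)
  where
  choose : ∀ c → c ≡ a ⊎ c ≡ b
  choose c with c ≟ a | c ≟ b
  ... | yes c≡a | _       = inj₁ c≡a
  ... | no _    | yes c≡b = inj₂ c≡b
  ... | no c≢a  | no c≢b  = contradiction (c , c≢a , c≢b) none

  bit : ∀ {c} → c ≡ a ⊎ c ≡ b → Fin 2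
  bit (inj₁ _) = zero
  bit (inj₂ _) = suc zero

  code : Fin n → Fin 2
  code c = bit (choose c)

  bit-injective : ∀ {c d} (p : c ≡ a ⊎ c ≡ b) (q : d ≡ a ⊎ d ≡ b) → bit p ≡ bit q → c ≡ d
  bit-injective (inj₁ p) (inj₁ q) _ = trans p (sym q)
  bit-injective (inj₂ p) (inj₂ q) _ = trans p (sym q)
  bit-injective (inj₁ _) (inj₂ _) ()
  bit-injective (inj₂ _) (inj₁ _) ()

  code-injective : ∀ {c d} → code c ≡ code d → c ≡ d
  code-injective {c} {d} = bit-injective (choose c) (choose d)

module Tree {n} (G : Graph n) (acyclic : Acyclic (Graph._~_ G)) (twin-free : TwinFree (Graph._~_ G)) where
  open Graph G renaming (sym to ~-sym)

  pendant? : ∀ y x → Dec (Pendant _~_ y x)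
  pendant? y x = (y ~? x) ×-dec all? (λ w → (w ~? x) →-dec (w ≟ y))

  reduced-length : ∀ {L P} → Reduced _~_ L P → suc L ≤ n
  reduced-length {P = P} r = injective⇒≤ {f = P ∘ toℕ}
    λ {i} {j} eq → toℕ-injective (acyclic _ r _ _ (s≤s⁻¹ (toℕ<n i)) (s≤s⁻¹ (toℕ<n j)) eq)

  -- `x` lies on the `v` side of the edge `p v`. The form is negative because it is used against
  -- explicit walks that pass from `v` through `p` to the two loose leaves.
  Beyond : Fin n → Fin n → Fin n → Set
  Beyond p v x = ∀ {L P} → Reduced _~_ (suc L) P → P 0 ≡ v → P 1 ≡ p →
    ∀ i → i ≤ L → P (suc i) ≢ x

  beyond-self : ∀ {p v} → Beyond p v v
  beyond-self r refl _ i i≤L eq with acyclic _ r (suc i) 0 (s≤s i≤L) z≤n eq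
  ... | ()

  beyond-step : ∀ {p v w x} → w ~ v → w ≢ p → Beyond v w x → Beyond p v x
  beyond-step w~v w≢p h r refl refl i i≤L = h (cons _~_ w~v w≢p r) refl refl (suc i) (s≤s i≤L)

  -- The neighbour of an anchored leaf has degree two, but `v` has three different neighbours.
  pendant-loose : ∀ {v w a b} → Pendant _~_ v w → a ~ v → b ~ v → a ≢ b → a ≢ w → b ≢ w → Loose _~_ w
  pendant-loose {v} {w} pend a~v b~v a≢b a≢w b≢w = (v , pend) , ¬anch
    where
    ¬anch : ¬ Anchored _~_ w
    ¬anch (y , z , _ , ((y~w , _) , _ , _ , deg) , _) with proj₂ pend y y~w
    ... | refl with deg _ a~v | deg _ b~v
    ...   | inj₁ a≡w | _        = a≢w a≡w
    ...   | inj₂ _   | inj₁ b≡w = b≢w b≡w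
    ...   | inj₂ a≡z | inj₂ b≡z = a≢b (trans a≡z (sym b≡z))

  -- The only vertex that could anchor `t` is `v`, and it carries no leaf.
  limb-loose : ∀ {t c v} → Neck _~_ t c v → (∀ w → ¬ Pendant _~_ v w) → Loose _~_ t
  limb-loose {t} {c} {v} (pend , v~c , v≢t , deg) no-leaf = (c , pend) , ¬anch
    where
    ¬anch : ¬ Anchored _~_ t
    ¬anch (y , z , w , ((y~t , _) , _ , _ , deg′) , pend′) with proj₂ pend y y~t
    ... | refl with deg′ v v~c
    ...   | inj₁ v≡t  = v≢t v≡t
    ...   | inj₂ refl = no-leaf w pend′

  data Branch (p v : Fin n) : Set where
    leaf  : Pendant _~_ p v → Branch p v
    limb  : ∀ t → Neck _~_ t v p → Branch p v
    loose : ∀ x → Loose _~_ x → Beyond p v x → Branch p v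

  -- A branch without loose vertices has depth at most two.  The fuel bounds
  -- the number of vertices not yet on the walk.
  branch : ∀ fuel {L P p v} → n ≤ fuel + suc L → Reduced _~_ (suc L) P → P 0 ≡ v → P 1 ≡ p →
    ¬ Pendant _~_ v p → Branch p v
  branch zero n≤ r _ _ _ = contradiction n≤ (ℕₚ.<⇒≱ (reduced-length r))
  branch (suc fuel) {L} {p = p} {v} n≤ r refl refl ¬pend = examine
    where
    Child : Fin n → Set
    Child c = c ~ v × c ≢ p

    p~v : p ~ v
    p~v = ~-sym (adj r 0 (s≤s z≤n))

    Short : Fin n → Set
    Short c = Child c → Pendant _~_ v c ⊎ ∃[ t ] Neck _~_ t c v

    Deep : Fin n → Set
    Deep c = Child c × ∃[ x ] (Loose _~_ x × Beyond v c x)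

    inspect : ∀ c → Short c ⊎ Deep c
    inspect c with (c ~? v) ×-dec ¬? (c ≟ p)
    ... | no ¬child = inj₁ λ child → contradiction child ¬child
    ... | yes child@(c~v , c≢p)
      with branch fuel (≤-trans n≤ (ℕₚ.≤-reflexive (sym (ℕₚ.+-suc fuel (suc L)))))
             (cons _~_ c~v c≢p r) refl refl (λ pend → c≢p (sym (proj₂ pend p p~v)))
    ...   | leaf pend       = inj₁ λ _ → inj₁ pend
    ...   | limb t neck     = inj₁ λ _ → inj₂ (t , neck)
    ...   | loose x lx far  = inj₂ (child , x , lx , far)

    Limb : Fin n → Set
    Limb c = Child c × ∃[ t ] Neck _~_ t c v

    divide : (∀ c → Short c) → ∀ c → (Child c → Pendant _~_ v c) ⊎ Limb c
    divide short c with (c ~? v) ×-dec ¬? (c ≟ p)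
    ... | no ¬child = inj₁ λ child → contradiction child ¬child
    ... | yes child with short c child
    ...   | inj₁ pend = inj₁ λ _ → pend
    ...   | inj₂ neck = inj₂ (child , neck)

    -- Twin-freeness leaves room for at most one leaf child, so `v` is a leaf itself or the middle
    -- of a leg.
    only-leaves : (∀ c → Child c → Pendant _~_ v c) → Branch p v
    only-leaves pend with any? (λ c → (c ~? v) ×-dec ¬? (c ≟ p))
    ... | no none = leaf (p~v , λ w w~v → decidable-stable (w ≟ p) λ w≢p → none (w , w~v , w≢p))
    ... | yes (c , c~v , c≢p) = limb c (pend c (c~v , c≢p) , p~v , ≢-sym c≢p , two)
      where
      two : ∀ u → u ~ v → u ≡ c ⊎ u ≡ p
      two u u~v with u ≟ p
      ... | yes u≡p = inj₂ u≡p
      ... | no  u≢p = inj₁ (twin-free (pend u (u~v , u≢p)) (pend c (c~v , c≢p)))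

    -- A leg at `v` forces a loose vertex: its tip if `v` carries no leaf, and otherwise that leaf,
    -- because `v` has the three neighbours `p`, `c` and `w`.
    with-limb : ∀ {c} → Limb c → Branch p v
    with-limb {c} ((c~v , c≢p) , t , neck@((c~t , _) , v~c , v≢t , _)) with any? (pendant? v)
    ... | no none = loose t (limb-loose neck (λ w pend → none (w , pend)))
      (beyond-step c~v c≢p (beyond-step (~-sym c~t) (≢-sym v≢t) beyond-self))
    ... | yes (w , pend) = loose w (pendant-loose pend p~v c~v (≢-sym c≢p) p≢w c≢w)
      (beyond-step (~-sym (proj₁ pend)) (≢-sym p≢w) beyond-self)
      where
      p≢w : p ≢ w
      p≢w refl = ¬pend pend

      c≢w : c ≢ w
      c≢w refl = v≢t (sym (proj₂ pend t (~-sym c~t)))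

    examine : Branch p v
    examine with search inspect
    ... | inj₂ (c , (c~v , c≢p) , x , lx , far) = loose x lx (beyond-step c~v c≢p far)
    ... | inj₁ short with search (divide short)
    ...   | inj₁ leaves   = only-leaves leaves
    ...   | inj₂ (c , l)  = with-limb l

  branch-at : ∀ {p v} → v ~ p → ¬ Pendant _~_ v p → Branch p v
  branch-at v~p = branch n (ℕₚ.m≤m+n n 1) (single _~_ v~p) refl refl

-- The barbell along the path between the loose leaves

legs : ℕ → ℕ → Side → ℕ
legs a b left  = a
legs a b right = b

lookup-injective : {A : Set} {xs : List A} → Unique xs →
  ∀ {i j} → lookup xs i ≡ lookup xs j → i ≡ j
lookup-injective (_   ∷ _) {zero}  {zero}  _  = refl
lookup-injective (x∉  ∷ _) {zero}  {suc j} eq = contradiction eq (All.lookup x∉ (∈-lookup j))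
lookup-injective (x∉  ∷ _) {suc i} {zero}  eq = contradiction (sym eq) (All.lookup x∉ (∈-lookup i))
lookup-injective (_   ∷ u) {suc i} {suc j} eq = cong suc (lookup-injective u eq)

module Spine {n} (G : Graph n) (acyclic : Acyclic (Graph._~_ G)) (twin-free : TwinFree (Graph._~_ G))
  {c P} (r : Reduced (Graph._~_ G) (3 + c) P)
  (pend₀ : Pendant (Graph._~_ G) (P 1) (P 0))
  (pendₗ : Pendant (Graph._~_ G) (P (2 + c)) (P (3 + c)))
  (only : ∀ z → Loose (Graph._~_ G) z → z ≡ P 0 ⊎ z ≡ P (3 + c)) where

  open Graph G renaming (sym to ~-sym)
  open Tree G acyclic twin-free

  -- Indexed by the vertex below, so that both path neighbours are written without subtraction.
  Off : ℕ → Fin n → Set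
  Off i w = w ~ P (suc i) × w ≢ P i × w ≢ P (2 + i)

  off? : ∀ i w → Dec (Off i w)
  off? i w = (w ~? P (suc i)) ×-dec ¬? (w ≟ P i) ×-dec ¬? (w ≟ P (2 + i))

  module _ {i w} (i< : suc i < 3 + c) (off : Off i w) where

    private
      w~ = proj₁ off
      w≢below = proj₁ (proj₂ off)
      w≢above = proj₂ (proj₂ off)

    below~ : P i ~ P (suc i)
    below~ = adj r i (ℕₚ.<-trans ≤-refl i<)

    above~ : P (2 + i) ~ P (suc i)
    above~ = ~-sym (adj r (suc i) i<)

    -- From `P (suc i)` the path can be followed down to `P 0` and up to `P (3 + c)`, so neither of
    -- the two loose vertices lies behind `w`.
    loose-not-beyond : ∀ {x} → Beyond (P (suc i)) w x → ¬ Loose _~_ x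
    loose-not-beyond far lx = [ below , above ]′ (only _ lx)
      where
      below : _ ≢ P 0
      below x≡ = far (cons _~_ w~ w≢below (reverse _~_ ~-sym (restrict _~_ (ℕₚ.<⇒≤ i<) r))) refl refl
        (suc i) ≤-refl (trans (cong P (ℕₚ.n∸n≡0 i)) (sym x≡))

      L≡ : 3 + c ∸ suc i + suc i ≡ 3 + c
      L≡ = ℕₚ.m∸n+n≡m (ℕₚ.<⇒≤ i<)

      above : _ ≢ P (3 + c)
      above x≡ = far (cons _~_ w~ w≢above
          (drop _~_ (suc i) {3 + c ∸ suc i} (subst (λ l → Reduced _~_ l P) (sym L≡) r))) refl refl
        (3 + c ∸ suc i) ≤-refl (trans (cong P L≡) (sym x≡))

    -- With its two path neighbours `P (suc i)` would have degree at least three, which makes the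
    -- leaf `w` loose although it is off the path.
    off-not-pendant : ¬ Pendant _~_ (P (suc i)) w
    off-not-pendant pend = loose-not-beyond beyond-self
      (pendant-loose pend below~ above~ (nb r i i<) (≢-sym w≢below) (≢-sym w≢above))

    off-neck : ∃[ t ] Neck _~_ t w (P (suc i))
    off-neck with branch-at w~ (λ pend → w≢below (sym (proj₂ pend _ below~)))
    ... | leaf pend      = contradiction pend off-not-pendant
    ... | limb t neck    = t , neck
    ... | loose x lx far = contradiction lx (loose-not-beyond far)

  -- The tip of the leg is not loose, so `P (suc i)` carries a leaf. That leaf cannot hang off the
  -- path, hence is a path neighbour, and a path vertex that is a leaf must be an end.
  off-at-hub : ∀ {i w} → suc i < 3 + c → Off i w → ∃[ s ] i ≡ pre c s
  off-at-hub {i} {w} i< off with off-neck i< off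
  ... | t , neck@((w~t , _) , _ , v≢t , _) with any? (pendant? (P (suc i)))
  ...   | no none = contradiction (limb-loose neck (λ u pend → none (u , pend)))
    (loose-not-beyond i< off (beyond-step (~-sym w~t) (≢-sym v≢t) beyond-self))
  ...   | yes (u , pend) = locate (u ≟ P i) (u ≟ P (2 + i))
    where
    locate : Dec (u ≡ P i) → Dec (u ≡ P (2 + i)) → ∃[ s ] i ≡ pre c s
    locate (yes refl) _ = at-start i i< pend
      where
      at-start : ∀ i → suc i < 3 + c → Pendant _~_ (P (suc i)) (P i) → ∃[ s ] i ≡ pre c s
      at-start zero    _  _    = left , refl
      at-start (suc i) i< pend = contradiction
        (proj₂ pend _ (adj r i (ℕₚ.<-trans ≤-refl (ℕₚ.<-trans ≤-refl i<))))
        (nb r i (ℕₚ.<-trans ≤-refl i<))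
    locate (no _) (yes refl) with suc i ℕₚ.≟ 2 + c
    ... | yes eq = right , ℕₚ.suc-injective eq
    ... | no neq = contradiction
      (sym (proj₂ pend _ (~-sym (adj r (2 + i) 3+i≤))))
      (nb r (suc i) 3+i≤)
      where
      3+i≤ : 2 + i < 3 + c
      3+i≤ = s≤s (ℕₚ.≤∧≢⇒< (s≤s⁻¹ i<) neq)
    locate (no u≢below) (no u≢above) = contradiction pend
      (off-not-pendant i< (~-sym (proj₁ pend) , u≢below , u≢above))

  offs : Side → List (Fin n)
  offs s = filter (off? (pre c s)) (allFin n)

  hub<3+c : ∀ s → hub c s < 3 + c
  hub<3+c left  = s≤s (s≤s z≤n)
  hub<3+c right = ≤-refl

  -- Spelled with `legs`, and not as a function of the side, so that the barbell has the form asked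
  -- for by `Barbelled`.
  k : Side → ℕ
  k = legs (length (offs left)) (length (offs right))

  foot : ∀ s → Fin (k s) → Fin n
  foot left  = lookup (offs left)
  foot right = lookup (offs right)

  lookup-off : ∀ s i → Off (pre c s) (lookup (offs s) i)
  lookup-off s i = proj₂ (∈-filter⁻ (off? (pre c s)) {xs = allFin n} (∈-lookup {xs = offs s} i))

  foot-off : ∀ s a → Off (pre c s) (foot s a)
  foot-off left  = lookup-off left
  foot-off right = lookup-off right

  lookup-complete : ∀ s {w} → Off (pre c s) w → ∃[ i ] lookup (offs s) i ≡ w
  lookup-complete s {w} off = index w∈ , sym (lookup-index w∈)
    where
    w∈ : w ∈ˡ offs s
    w∈ = ∈-filter⁺ (off? (pre c s)) (∈-allFin w) off

  foot-complete : ∀ s {w} → Off (pre c s) w → Σ (Fin (k s)) λ a → foot s a ≡ w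
  foot-complete left  = lookup-complete left
  foot-complete right = lookup-complete right

  foot-injective : ∀ s {a b} → foot s a ≡ foot s b → a ≡ b
  foot-injective left  = lookup-injective (Unique.filter⁺ (off? 0) (Unique.allFin⁺ n))
  foot-injective right = lookup-injective (Unique.filter⁺ (off? (1 + c)) (Unique.allFin⁺ n))

  foot-neck : ∀ s a → ∃[ t ] Neck _~_ t (foot s a) (P (hub c s))
  foot-neck s a = off-neck (hub<3+c s) (foot-off s a)

  open Barbell k c

  embed : Vertex → Fin n
  embed (pt i)    = P (toℕ i)
  embed (mid s a) = foot s a
  embed (tip s a) = proj₁ (foot-neck s a)

  embed-⟶ : ∀ {u v} → u ⟶ v → embed u ~ embed v
  embed-⟶ (path {i} {j} eq) = subst (λ m → P m ~ P (toℕ j)) (sym eq)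
    (~-sym (adj r (toℕ j) (subst (_≤ 3 + c) eq (s≤s⁻¹ (toℕ<n i)))))
  embed-⟶ (limb {s} {a} eq) = subst (λ m → foot s a ~ P m) (sym eq) (proj₁ (foot-off s a))
  embed-⟶ (toe {s} {a})     = ~-sym (proj₁ (proj₁ (proj₂ (foot-neck s a))))

  embed-∼ : ∀ {u v} → u ∼ v → embed u ~ embed v
  embed-∼ = [ embed-⟶ , ~-sym ∘ embed-⟶ ]′

  P-injective : ∀ {i j : Fin (4 + c)} → P (toℕ i) ≡ P (toℕ j) → i ≡ j
  P-injective {i} {j} eq =
    toℕ-injective (acyclic _ r _ _ (s≤s⁻¹ (toℕ<n i)) (s≤s⁻¹ (toℕ<n j)) eq)

  P≢foot : ∀ s a {i j : Fin (4 + c)} → pt j ∼ pt i → toℕ i ≡ hub c s → P (toℕ j) ≢ foot s a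
  P≢foot s a (inj₁ (path e)) i≡ eq = proj₂ (proj₂ (foot-off s a))
    (trans (sym eq) (cong P (trans e (cong suc i≡))))
  P≢foot s a (inj₂ (path e)) i≡ eq = proj₁ (proj₂ (foot-off s a))
    (trans (sym eq) (cong P (ℕₚ.suc-injective (trans (sym e) i≡))))

  tip≢hub : ∀ s a {i : Fin (4 + c)} → toℕ i ≡ hub c s → P (toℕ i) ≢ embed (tip s a)
  tip≢hub s a i≡ eq = proj₁ (proj₂ (proj₂ (proj₂ (foot-neck s a)))) (trans (cong P (sym i≡)) eq)

  foot-side : ∀ {s t} {a : Fin (k s)} {b : Fin (k t)} → hub c s ≡ hub c t →
    foot s a ≡ foot t b → mid s a ≡ mid t b
  foot-side {s} {t} hubs eq with hub-injective {s} {t} hubs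
  ... | refl = cong (mid s) (foot-injective s eq)

  embed-locally-injective : ∀ {a u v} → a ∼ u → a ∼ v → embed u ≡ embed v → u ≡ v
  embed-locally-injective {pt i} {pt _} {pt _} p q eq = cong pt (P-injective eq)
  embed-locally-injective {pt i} {pt _} {mid s a} p (inj₂ (limb i≡)) eq =
    contradiction eq (P≢foot s a (∼-sym p) i≡)
  embed-locally-injective {pt i} {mid s a} {pt _} (inj₂ (limb i≡)) q eq =
    contradiction (sym eq) (P≢foot s a (∼-sym q) i≡)
  embed-locally-injective {pt i} {mid s a} {mid t b} (inj₂ (limb p)) (inj₂ (limb q)) eq =
    foot-side (trans (sym p) q) eq
  embed-locally-injective {pt i} {tip _ _} (inj₁ ())
  embed-locally-injective {pt i} {tip _ _} (inj₂ ())
  embed-locally-injective {pt i} {_} {tip _ _} _ (inj₁ ())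
  embed-locally-injective {pt i} {_} {tip _ _} _ (inj₂ ())
  embed-locally-injective {mid s a} (inj₁ (limb p)) (inj₁ (limb q)) _ =
    cong pt (toℕ-injective (trans p (sym q)))
  embed-locally-injective {mid s a} (inj₁ (limb p)) (inj₂ toe) eq = contradiction eq (tip≢hub s a p)
  embed-locally-injective {mid s a} (inj₂ toe) (inj₁ (limb q)) eq =
    contradiction (sym eq) (tip≢hub s a q)
  embed-locally-injective {mid s a} (inj₂ toe) (inj₂ toe) _ = refl
  embed-locally-injective {tip s a} (inj₁ toe) (inj₁ toe) _ = refl

  Lifts : Vertex → Fin n → Set
  Lifts a y = ∃[ b ] (a ∼ b × embed b ≡ y)

  lift-above : ∀ {i y} → toℕ i < 3 + c → y ≡ P (suc (toℕ i)) → Lifts (pt i) y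
  lift-above {i} i< y≡ with point (suc (toℕ i)) (s≤s i<)
  ... | j , j≡ = pt j , inj₂ (path j≡) , trans (cong P j≡) (sym y≡)

  lift-below : ∀ {i y} → y ≡ P (toℕ i) → Lifts (pt (suc i)) y
  lift-below {i} y≡ = pt (inject₁ i) , inj₁ (path (cong suc (sym (toℕ-inject₁ i)))) ,
    trans (cong P (toℕ-inject₁ i)) (sym y≡)

  embed-locally-surjective : ∀ a {y} → embed a ~ y → Lifts a y
  embed-locally-surjective (pt zero) e = lift-above (s≤s z≤n) (proj₂ pend₀ _ (~-sym e))
  embed-locally-surjective (pt (suc i)) {y} e with toℕ i ℕₚ.≟ 2 + c
  ... | yes i≡ = lift-below (trans
    (proj₂ pendₗ y (subst (λ m → y ~ P (suc m)) i≡ (~-sym e))) (cong P (sym i≡)))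
  ... | no i≢ = inner (y ≟ P (toℕ i)) (y ≟ P (2 + toℕ i))
    where
    i< : suc (toℕ i) < 3 + c
    i< = s≤s (ℕₚ.≤∧≢⇒< (s≤s⁻¹ (toℕ<n i)) i≢)

    inner : Dec (y ≡ P (toℕ i)) → Dec (y ≡ P (2 + toℕ i)) → Lifts (pt (suc i)) y
    inner (yes y≡) _        = lift-below y≡
    inner (no _)   (yes y≡) = lift-above i< y≡
    inner (no y≢)  (no y≢′) = at-hub (off-at-hub i< off)
      where
      off : Off (toℕ i) y
      off = ~-sym e , y≢ , y≢′

      at-hub : ∃[ s ] toℕ i ≡ pre c s → Lifts (pt (suc i)) y
      at-hub (s , i≡) with foot-complete s (subst (λ m → Off m y) i≡ off)
      ... | a , eq = mid s a , inj₂ (limb (cong suc i≡)) , eq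
  embed-locally-surjective (mid s a) {y} e with foot-neck s a in eq
  ... | t , (_ , _ , _ , deg) with deg y (~-sym e)
  ...   | inj₁ y≡t = tip s a , inj₂ toe , trans (cong proj₁ eq) (sym y≡t)
  ...   | inj₂ y≡hub with point (hub c s) (hub< s)
  ...     | j , j≡ = pt j , inj₁ (limb j≡) , trans (cong P j≡) (sym y≡hub)
  embed-locally-surjective (tip s a) {y} e = mid s a , inj₁ toe ,
    sym (proj₂ (proj₁ (proj₂ (foot-neck s a))) y (~-sym e))

  barbell≃ : Connected G → _∼_ ≃ _~_
  barbell≃ conn = covering-iso _≟ᵛ_ ∼-sym ∼-connected ~-sym acyclic conn root embed
    embed-∼ embed-locally-injective embed-locally-surjective

  footless : ∀ s → ¬ 1 ≤ k s → ∀ {u} → u ~ P (hub c s) → u ≡ P (pre c s) ⊎ u ≡ P (suc (hub c s))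
  footless s none {u} u~ with u ≟ P (pre c s) | u ≟ P (suc (hub c s))
  ... | yes u≡ | _      = inj₁ u≡
  ... | no _   | yes u≡ = inj₂ u≡
  ... | no u≢  | no u≢′ = contradiction (≤-trans (s≤s z≤n) (toℕ<n a)) none
    where
    a : Fin (k s)
    a = proj₁ (foot-complete s (u~ , u≢ , u≢′))

  -- A missing foot between adjacent hubs produces exactly the anchoring that `Wide` rules out.
  spine-wide : Loose _~_ (P 0) → Loose _~_ (P (3 + c)) → Wide
  spine-wide (_ , ¬anch₀) (_ , ¬anchₗ) with c ℕₚ.≟ 0
  ... | no c≢0  = inj₁ (ℕₚ.n≢0⇒n>0 c≢0)
  ... | yes c≡0 = inj₂ λ s → decidable-stable (1 ℕₚ.≤? k s) (footed s)
    where
    P₁₊ : P (1 + c) ≡ P 1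
    P₁₊ = cong (P ∘ suc) c≡0

    P₂₊ : P (2 + c) ≡ P 2
    P₂₊ = cong (λ m → P (2 + m)) c≡0

    footed : ∀ s → ¬ ¬ 1 ≤ k s
    footed left none = ¬anch₀ (P 1 , P 2 , P (3 + c) ,
      (pend₀ , ~-sym (adj r 1 (s≤s (s≤s z≤n))) , ≢-sym (nb r 0 (s≤s (s≤s z≤n))) ,
        λ u u~ → footless left none u~) ,
      subst (λ v → Pendant _~_ v (P (3 + c))) P₂₊ pendₗ)
    footed right none = ¬anchₗ (P (2 + c) , P (1 + c) , P 0 ,
      (pendₗ , adj r (1 + c) (s≤s (s≤s (n≤1+n c))) , nb r (1 + c) ≤-refl ,
        λ u u~ → Sum.swap (footless right none u~)) ,
      subst (λ v → Pendant _~_ v (P 0)) (sym P₁₊) pend₀)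

module _ {n} (G : Graph n) (conn : Connected G) (acyclic : Acyclic (Graph._~_ G))
         (twin-free : TwinFree (Graph._~_ G)) (3≤n : 3 ≤ n) where
  open Graph G renaming (sym to ~-sym)

  pendants-apart : ∀ {u v} → Pendant _~_ u v → ¬ Pendant _~_ v u
  pendants-apart {u} {v} (u~v , only-v) (v~u , only-u) with third-vertex 3≤n u v
  ... | w , w≢u , w≢v with crossing (λ a → (a ≟ u) ⊎-dec (a ≟ v)) (conn u w) (inj₁ refl) [ w≢u , w≢v ]′
  ...   | _ , b , a~b , inj₁ refl , b∉ = b∉ (inj₂ (only-u b (~-sym a~b)))
  ...   | _ , b , a~b , inj₂ refl , b∉ = b∉ (inj₁ (only-v b (~-sym a~b)))

  Barbelled : Set
  Barbelled = ∃[ a ] ∃[ b ] ∃[ c ] (Barbell.Wide (legs a b) c × Barbell._∼_ (legs a b) c ≃ _~_)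

  barbelled : ExactlyTwo (Loose _~_) → Barbelled
  barbelled (x , y , x≢y , lx , ly , only) with reach _~_ ~-sym _≟_ (conn x y)
  ... | inj₁ y≡x = contradiction (sym y≡x) x≢y
  ... | inj₂ (_ , _ , via) with via-walk _~_ ~-sym via
  ...   | L , P , r , refl , _ , refl = shape L r ly lx (λ z → Sum.swap ∘ only z)
    where
    pendant-to : ∀ {u v} → Loose _~_ u → v ~ u → Pendant _~_ v u
    pendant-to ((w , pend) , _) v~u = subst (λ t → Pendant _~_ t _) (sym (proj₂ pend _ v~u)) pend

    shape : ∀ L → Reduced _~_ (suc L) P → Loose _~_ (P 0) → Loose _~_ (P (suc L)) →
      (∀ z → Loose _~_ z → z ≡ P 0 ⊎ z ≡ P (suc L)) → Barbelled
    shape L r l₀ lₗ only with pendant-to l₀ (~-sym (adj r 0 (s≤s z≤n))) | pendant-to lₗ (adj r L ≤-refl)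
    -- Length one would make the two leaves a component of their own, and length two would make them
    -- twins. At least three edges remain, hence `3 + c`.
    shape zero          r l₀ lₗ only | p₀ | pₗ = contradiction pₗ (pendants-apart p₀)
    shape (suc zero)    r l₀ lₗ only | p₀ | pₗ = contradiction (twin-free p₀ pₗ) (nb r 0 ≤-refl)
    shape (suc (suc c)) r l₀ lₗ only | p₀ | pₗ = _ , _ , c , spine-wide l₀ lₗ , barbell≃ conn
      where open Spine G acyclic twin-free r p₀ pₗ only

-- Mirror images and the normal form

flip : Side → Side
flip left  = right
flip right = left

module _ {c : ℕ} where

  opposite-suc : ∀ {i j : Fin (4 + c)} → toℕ i ≡ suc (toℕ j) → toℕ (opposite j) ≡ suc (toℕ (opposite i))
  opposite-suc {i} {j} eq = begin
    toℕ (opposite j)           ≡⟨ opposite-prop j ⟩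
    3 + c ∸ toℕ j              ≡⟨ ∸-step j< ⟩
    suc (3 + c ∸ suc (toℕ j))  ≡⟨ cong (λ m → suc (3 + c ∸ m)) (sym eq) ⟩
    suc (3 + c ∸ toℕ i)        ≡⟨ cong suc (sym (opposite-prop i)) ⟩
    suc (toℕ (opposite i))     ∎
    where
    open ≡-Reasoning
    j< : toℕ j < 3 + c
    j< = subst (_≤ 3 + c) eq (s≤s⁻¹ (toℕ<n i))

  opposite-hub : ∀ s {i : Fin (4 + c)} → toℕ i ≡ hub c s → toℕ (opposite i) ≡ hub c (flip s)
  opposite-hub left  {i} eq = trans (opposite-prop i) (cong (3 + c ∸_) eq)
  opposite-hub right {i} eq = trans (opposite-prop i)
    (trans (cong (3 + c ∸_) eq) (ℕₚ.m+n∸n≡m 1 c))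

  mirror : ∀ a b → Barbell.Vertex (legs a b) c → Barbell.Vertex (legs b a) c
  mirror a b (Barbell.pt i)        = Barbell.pt (opposite i)
  mirror a b (Barbell.mid left i)  = Barbell.mid right i
  mirror a b (Barbell.mid right i) = Barbell.mid left i
  mirror a b (Barbell.tip left i)  = Barbell.tip right i
  mirror a b (Barbell.tip right i) = Barbell.tip left i

  mirror-involutive : ∀ a b v → mirror b a (mirror a b v) ≡ v
  mirror-involutive a b (Barbell.pt i)        = cong Barbell.pt (opposite-involutive i)
  mirror-involutive a b (Barbell.mid left i)  = refl
  mirror-involutive a b (Barbell.mid right i) = refl
  mirror-involutive a b (Barbell.tip left i)  = refl
  mirror-involutive a b (Barbell.tip right i) = refl

  mirror-⟶ : ∀ a b {u v} → Barbell._⟶_ (legs a b) c u v →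
    Barbell._∼_ (legs b a) c (mirror a b u) (mirror a b v)
  mirror-⟶ a b (Barbell.path eq)           = inj₂ (Barbell.path (opposite-suc eq))
  mirror-⟶ a b (Barbell.limb {left} eq)    = inj₁ (Barbell.limb (opposite-hub left eq))
  mirror-⟶ a b (Barbell.limb {right} eq)   = inj₁ (Barbell.limb (opposite-hub right eq))
  mirror-⟶ a b (Barbell.toe {left})        = inj₁ Barbell.toe
  mirror-⟶ a b (Barbell.toe {right})       = inj₁ Barbell.toe

  mirror-∼ : ∀ a b {u v} → Barbell._∼_ (legs a b) c u v →
    Barbell._∼_ (legs b a) c (mirror a b u) (mirror a b v)
  mirror-∼ a b (inj₁ e) = mirror-⟶ a b e
  mirror-∼ a b (inj₂ e) = Sum.swap (mirror-⟶ a b e)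

  mirror≃ : ∀ a b → Barbell._∼_ (legs a b) c ≃ Barbell._∼_ (legs b a) c
  mirror≃ a b = record
    { to        = mirror a b
    ; from      = mirror b a
    ; to∘from   = mirror-involutive b a
    ; from∘to   = mirror-involutive a b
    ; to-pres   = mirror-∼ a b
    ; from-pres = mirror-∼ b a
    }

  mirror-wide : ∀ {a b} → Barbell.Wide (legs a b) c → Barbell.Wide (legs b a) c
  mirror-wide (inj₁ 1≤c) = inj₁ 1≤c
  mirror-wide (inj₂ 1≤k) = inj₂ λ { left → 1≤k right ; right → 1≤k left }

-- Writing the number of right legs as a + e normalises the barbell to have
-- at least as many right legs as left ones.
record Shape (n a e : ℕ) : Set where
  constructor shape
  field
    bar   : ℕ
    order : n ≡ size (legs a (a + e)) bar
    wide  : Barbell.Wide (legs a (a + e)) bar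

classify : ∀ {n} (G : Graph n) → 5 ≤ n → IsTree G → MinusCritical 2 G →
  ∃₂ λ a e → Σ (Shape n a e) λ σ →
    Barbell._∼_ (legs a (a + e)) (Shape.bar σ) ≃ Graph._~_ G
classify {n} G 5≤n tree crit with Equivalence.to (MinusCritical⇔ G tree 5≤n) crit
... | tf , two with barbelled G (proj₁ tree) (¬Cycle⇒Acyclic G (proj₂ tree)) tf (≤-trans (s≤s (s≤s (s≤s z≤n))) 5≤n) two
...   | a , b , c , wide , I = ordered (ℕₚ.≤-total a b)
  where
  Shaped : ℕ → ℕ → Set
  Shaped a e = Σ (Shape n a e) λ σ → Barbell._∼_ (legs a (a + e)) (Shape.bar σ) ≃ Graph._~_ G

  build : ∀ {a b} → a ≤ b → Barbell.Wide (legs a b) c → Barbell._∼_ (legs a b) c ≃ Graph._~_ G →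
    ∃₂ Shaped
  build {a} a≤b wide I with ℕₚ.m≤n⇒∃[o]m+o≡n a≤b
  ... | e , refl = a , e , shape c order wide , I
    where
    order : n ≡ size (legs a (a + e)) c
    order = ↔⇒≡ (↔-trans (mk↔ₛ′ (_≃_.from I) (_≃_.to I) (_≃_.from∘to I) (_≃_.to∘from I))
      (↔-sym (Barbell.vertex↔ (legs a (a + e)) c)))

  ordered : a ≤ b ⊎ b ≤ a → ∃₂ Shaped
  ordered (inj₁ a≤b) = build a≤b wide I
  ordered (inj₂ b≤a) = build b≤a (mirror-wide {a = a} {b} wide) (≃-trans (mirror≃ b a) I)


-- Counting

half⁺ : ∀ {m n} → m + m ≤ n → m ≤ ⌊ n /2⌋
half⁺ {m} {n} le = subst (_≤ ⌊ n /2⌋) (sym (ℕₚ.n≡⌊n+n/2⌋ m)) (ℕₚ.⌊n/2⌋-mono le)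

half⁻ : ∀ {m n} → m ≤ ⌊ n /2⌋ → m + m ≤ n
half⁻ {n = n} le = ≤-trans (ℕₚ.+-mono-≤ le (≤-trans le (ℕₚ.⌊n/2⌋≤⌈n/2⌉ n)))
  (ℕₚ.≤-reflexive (ℕₚ.⌊n/2⌋+⌈n/2⌉≡n n))

-- The strict inequality guarantees that the subtraction is not truncated.
<∸⇒+≤ : ∀ k {m n} → m < n ∸ k → k + suc m ≤ n
<∸⇒+≤ zero            lt = lt
<∸⇒+≤ (suc k) {n = suc n} lt = s≤s (<∸⇒+≤ k lt)

+≤⇒<∸ : ∀ k {m n} → k + suc m ≤ n → m < n ∸ k
+≤⇒<∸ zero    le = le
+≤⇒<∸ (suc k) (s≤s le) = +≤⇒<∸ k le

shift : ℕ × ℕ → ℕ × ℕ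
shift (a , e) = suc a , e

shift-injective : ∀ {p q} → shift p ≡ shift q → p ≡ q
shift-injective refl = refl

base : ℕ → ℕ × ℕ
base e = 0 , e

base-injective : ∀ {e e′} → base e ≡ base e′ → e ≡ e′
base-injective refl = refl

-- One step of the recursion on `a`. The number of choices in the row `a = 0` stays a parameter
-- because `wedge` and `shapes` differ there.
extend : List (ℕ × ℕ) → ℕ → List (ℕ × ℕ)
extend xs m = map shift xs ++ map base (upTo m)

module _ {xs : List (ℕ × ℕ)} {m : ℕ} where

  length-extend : length (extend xs m) ≡ length xs + m
  length-extend = trans (length-++ (map shift xs)) (cong₂ _+_ (length-map shift xs)
    (trans (length-map base (upTo m)) (length-upTo m)))

  extend-unique : Unique xs → Unique (extend xs m)
  extend-unique u = Unique.++⁺ (Unique.map⁺ shift-injective u)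
    (Unique.map⁺ base-injective (Unique.upTo⁺ m)) disjoint
    where
    disjoint : ∀ {p} → ¬ (p ∈ˡ map shift xs × p ∈ˡ map base (upTo m))
    disjoint (p , q) with ∈-map⁻ shift p | ∈-map⁻ base q
    ... | _ , _ , refl | _ , _ , ()

  ∈-extend-zero⁺ : ∀ {e} → e < m → (0 , e) ∈ˡ extend xs m
  ∈-extend-zero⁺ e< = ∈-++⁺ʳ (map shift xs) (∈-map⁺ base (∈-upTo⁺ e<))

  ∈-extend-suc⁺ : ∀ {a e} → (a , e) ∈ˡ xs → (suc a , e) ∈ˡ extend xs m
  ∈-extend-suc⁺ ∈xs = ∈-++⁺ˡ (∈-map⁺ shift ∈xs)

  ∈-extend-zero⁻ : ∀ {e} → (0 , e) ∈ˡ extend xs m → e < m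
  ∈-extend-zero⁻ mem with ∈-++⁻ (map shift xs) mem
  ... | inj₁ p with ∈-map⁻ shift p
  ...   | _ , _ , ()
  ∈-extend-zero⁻ mem | inj₂ q with ∈-map⁻ base q
  ...   | _ , e∈ , refl = ∈-upTo⁻ e∈

  ∈-extend-suc⁻ : ∀ {a e} → (suc a , e) ∈ˡ extend xs m → (a , e) ∈ˡ xs
  ∈-extend-suc⁻ mem with ∈-++⁻ (map shift xs) mem
  ... | inj₁ p with ∈-map⁻ shift p
  ...   | _ , ∈xs , refl = ∈xs
  ∈-extend-suc⁻ mem | inj₂ q with ∈-map⁻ base q
  ...   | _ , _ , ()

-- The pairs (a , e) with 2a + e < m.
wedge : ℕ → List (ℕ × ℕ)
wedge 0             = []
wedge 1             = extend [] 1
wedge (suc (suc m)) = extend (wedge m) (2 + m)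

wedge-unique : ∀ m → Unique (wedge m)
wedge-unique 0             = []
wedge-unique 1             = extend-unique []
wedge-unique (suc (suc m)) = extend-unique (wedge-unique m)

∈-wedge⁺ : ∀ m a {e} → a + (a + e) < m → (a , e) ∈ˡ wedge m
∈-wedge⁺ 1             zero    lt = ∈-extend-zero⁺ {[]} lt
∈-wedge⁺ 1             (suc a) (s≤s ())
∈-wedge⁺ (suc (suc m)) zero    lt = ∈-extend-zero⁺ {wedge m} lt
∈-wedge⁺ (suc (suc m)) (suc a) {e} lt = ∈-extend-suc⁺ (∈-wedge⁺ m a
  (s≤s⁻¹ (subst (_< suc m) (ℕₚ.+-suc a (a + e)) (s≤s⁻¹ lt))))

∈-wedge⁻ : ∀ m a {e} → (a , e) ∈ˡ wedge m → a + (a + e) < m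
∈-wedge⁻ 1             zero    mem = ∈-extend-zero⁻ {[]} mem
∈-wedge⁻ 1             (suc a) mem with ∈-extend-suc⁻ {[]} mem
... | ()
∈-wedge⁻ (suc (suc m)) zero    mem = ∈-extend-zero⁻ {wedge m} mem
∈-wedge⁻ (suc (suc m)) (suc a) {e} mem =
  s≤s (subst (_< suc m) (sym (ℕₚ.+-suc a (a + e))) (s≤s (∈-wedge⁻ m a (∈-extend-suc⁻ {wedge m} mem))))

length-wedge-even : ∀ j → length (wedge (j + j)) ≡ j * suc j
length-wedge-even zero    = refl
length-wedge-even (suc j) = begin
  length (wedge (suc j + suc j))            ≡⟨ cong (λ m → length (wedge (suc m))) (ℕₚ.+-suc j j) ⟩
  length (extend (wedge (j + j)) (2 + (j + j))) ≡⟨ length-extend {wedge (j + j)} ⟩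
  length (wedge (j + j)) + (2 + (j + j))    ≡⟨ cong (_+ (2 + (j + j))) (length-wedge-even j) ⟩
  j * suc j + (2 + (j + j))                 ≡⟨ solve 1 (λ j → j :* (con 1 :+ j) :+ (con 2 :+ (j :+ j))
                                                 := (con 1 :+ j) :* (con 2 :+ j)) refl j ⟩
  suc j * suc (suc j)                       ∎
  where open ≡-Reasoning

length-wedge-odd : ∀ j → length (wedge (suc (j + j))) ≡ suc j * suc j
length-wedge-odd zero    = refl
length-wedge-odd (suc j) = begin
  length (wedge (suc (suc j + suc j)))      ≡⟨ cong (λ m → length (wedge (suc (suc m)))) (ℕₚ.+-suc j j) ⟩
  length (extend (wedge (suc (j + j))) (3 + (j + j))) ≡⟨ length-extend {wedge (suc (j + j))} ⟩
  length (wedge (suc (j + j))) + (3 + (j + j)) ≡⟨ cong (_+ (3 + (j + j))) (length-wedge-odd j) ⟩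
  suc j * suc j + (3 + (j + j))             ≡⟨ solve 1 (λ j → (con 1 :+ j) :* (con 1 :+ j) :+ (con 3 :+ (j :+ j))
                                                 := (con 2 :+ j) :* (con 2 :+ j)) refl j ⟩
  suc (suc j) * suc (suc j)                 ∎
  where open ≡-Reasoning

-- The constants come from `n = 4 + c + 2 (2a + e)`. A positive `a` allows every `c`, so
-- `2a + e ≤ ⌊ n /2⌋ - 2`, and after lowering `a` by one `2a + e < ⌊ n /2⌋ - 3`. For `a = 0` the bar
-- must be positive, so `2e + 5 ≤ n`, which leaves `⌈ n /2⌉ - 2` values of `e`.
shapes : ℕ → List (ℕ × ℕ)
shapes n = extend (wedge (⌊ n /2⌋ ∸ 3)) (⌈ n /2⌉ ∸ 2)

shapes-unique : ∀ n → Unique (shapes n)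
shapes-unique n = extend-unique (wedge-unique (⌊ n /2⌋ ∸ 3))

shapes⁺ : ∀ {n a e} → Shape n a e → (a , e) ∈ˡ shapes n
shapes⁺ {n} {zero} {e} (shape c order (inj₁ 1≤c)) = ∈-extend-zero⁺ {wedge (⌊ n /2⌋ ∸ 3)}
  -- `⌈ n /2⌉` computes to `⌊ suc n /2⌋`, hence the comparison with `suc n`.
  (+≤⇒<∸ 2 (half⁺ {2 + suc e} (begin
    (3 + e) + (3 + e)    ≡⟨ solve 1 (λ e → (con 3 :+ e) :+ (con 3 :+ e) := con 1 :+ (con 4 :+ con 1 :+ (e :+ e))) refl e ⟩
    suc (4 + 1 + (e + e))  ≤⟨ s≤s (ℕₚ.+-monoˡ-≤ (e + e) (ℕₚ.+-monoʳ-≤ 4 1≤c)) ⟩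
    suc (4 + c + (e + e))  ≡⟨ cong suc (sym order) ⟩
    suc n                  ∎)))
  where open ℕₚ.≤-Reasoning
shapes⁺ {n} {zero} (shape c order (inj₂ 1≤k)) with 1≤k left
... | ()
shapes⁺ {n} {suc a} {e} (shape c order _) = ∈-extend-suc⁺ (∈-wedge⁺ _ a
  (+≤⇒<∸ 3 (half⁺ {3 + suc (a + (a + e))} (begin
    (4 + (a + (a + e))) + (4 + (a + (a + e)))
      ≡⟨ solve 2 (λ a e → (con 4 :+ (a :+ (a :+ e))) :+ (con 4 :+ (a :+ (a :+ e)))
           := con 4 :+ (((con 1 :+ a) :+ (con 1 :+ a :+ e)) :+ ((con 1 :+ a) :+ (con 1 :+ a :+ e)))) refl a e ⟩
    4 + ((suc a + (suc a + e)) + (suc a + (suc a + e)))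
      ≤⟨ ℕₚ.+-monoˡ-≤ ((suc a + (suc a + e)) + (suc a + (suc a + e))) (ℕₚ.m≤m+n 4 c) ⟩
    4 + c + ((suc a + (suc a + e)) + (suc a + (suc a + e))) ≡⟨ sym order ⟩
    n ∎))))
  where open ℕₚ.≤-Reasoning

shapes⁻ : ∀ {n} a {e} → (a , e) ∈ˡ shapes n → Shape n a e
shapes⁻ {n} zero {e} mem with ℕₚ.m≤n⇒∃[o]m+o≡n
  (half⁻ {2 + suc e} {suc n} (<∸⇒+≤ 2 (∈-extend-zero⁻ {wedge (⌊ n /2⌋ ∸ 3)} mem)))
-- The slack `c` of the inequality `6 + 2e ≤ suc n` becomes a bar of length `suc c`, which is
-- positive.
... | c , eq = shape (suc c) (ℕₚ.suc-injective (trans (sym eq)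
  (solve 2 (λ e c → (con 3 :+ e) :+ (con 3 :+ e) :+ c
     := con 1 :+ (con 4 :+ (con 1 :+ c) :+ (e :+ e))) refl e c))) (inj₁ (s≤s z≤n))
shapes⁻ {n} (suc a) {e} mem with ℕₚ.m≤n⇒∃[o]m+o≡n
  (half⁻ {3 + suc (a + (a + e))} {n} (<∸⇒+≤ 3 (∈-wedge⁻ (⌊ n /2⌋ ∸ 3) a (∈-extend-suc⁻ {wedge (⌊ n /2⌋ ∸ 3)} mem))))
... | c , eq = shape c (trans (sym eq)
  (solve 3 (λ a e c → (con 4 :+ (a :+ (a :+ e))) :+ (con 4 :+ (a :+ (a :+ e))) :+ c
     := con 4 :+ c :+ (((con 1 :+ a) :+ (con 1 :+ a :+ e)) :+ ((con 1 :+ a) :+ (con 1 :+ a :+ e))))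
    refl a e c)) (inj₂ λ { left → s≤s z≤n ; right → s≤s z≤n })

-- One tree for each shape

module _ {n : ℕ} {G H : Graph n} where
  private
    module G = Graph G
    module H = Graph H

  ≅⇒≃ : G ≅ H → G._~_ ≃ H._~_
  ≅⇒≃ (π , f) = record
    { to        = π ⟨$⟩ʳ_
    ; from      = π ⟨$⟩ˡ_
    ; to∘from   = λ _ → Perm.inverseʳ π
    ; from∘to   = λ _ → Perm.inverseˡ π
    ; to-pres   = λ {u} {v} → Equivalence.to (f u v)
    ; from-pres = λ {u} {v} e → Equivalence.from (f _ _)
        (subst₂ H._~_ (sym (Perm.inverseʳ π)) (sym (Perm.inverseʳ π)) e)
    }

  ≃⇒≅ : G._~_ ≃ H._~_ → G ≅ H
  ≃⇒≅ I = mk↔ₛ′ to from to∘from from∘to , λ u v → mk⇔ to-pres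
    (λ e → subst₂ G._~_ (from∘to u) (from∘to v) (from-pres e))
    where open _≃_ I

module _ {n : ℕ} (5≤n : 5 ≤ n) where

  shape-graph : ∀ {a e} → Shape n a e → Graph n
  shape-graph {a} {e} σ = Barbell.graph (legs a (a + e)) (Shape.bar σ) (Shape.order σ)

  shape-iso : ∀ {a e} (σ : Shape n a e) →
    Barbell._∼_ (legs a (a + e)) (Shape.bar σ) ≃ Graph._~_ (shape-graph σ)
  shape-iso {a} {e} σ = Barbell.graph-iso (legs a (a + e)) (Shape.bar σ) (Shape.order σ)

  shape-tree : ∀ {a e} → Shape n a e → Setoid.Carrier (minusCriticalTrees 2 n)
  shape-tree {a} {e} σ = shape-graph σ ,
    Barbell.graph-tree (legs a (a + e)) (Shape.bar σ) (Shape.order σ) ,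
    Barbell.graph-minus-critical (legs a (a + e)) (Shape.bar σ) (Shape.order σ) 5≤n (Shape.wide σ)

  shape-unique : ∀ {a e a′ e′} (σ : Shape n a e) (τ : Shape n a′ e′) →
    shape-graph σ ≅ shape-graph τ → (a , e) ≡ (a′ , e′)
  shape-unique {a} {e} {a′} {e′} σ τ iso = combine
    (legs-unique {legs a (a + e)} {legs a′ (a′ + e′)} {Shape.bar σ} {Shape.bar τ} (Shape.wide σ)
      (ℕₚ.m≤m+n a e) (ℕₚ.m≤m+n a′ e′)
      (≃-trans (shape-iso σ) (≃-trans (≅⇒≃ {G = shape-graph σ} {shape-graph τ} iso) (≃-sym (shape-iso τ)))))
    where
    combine : a ≡ a′ × a + e ≡ a′ + e′ → (a , e) ≡ (a′ , e′)
    combine (refl , eq) = cong (a ,_) (ℕₚ.+-cancelˡ-≡ a e e′ eq)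

  bar-unique : ∀ {a e} (σ τ : Shape n a e) → Shape.bar σ ≡ Shape.bar τ
  bar-unique {a} {e} σ τ = ℕₚ.+-cancelˡ-≡ 4 _ _ (ℕₚ.+-cancelʳ-≡ ((a + (a + e)) + (a + (a + e))) _ _
    (trans (sym (Shape.order σ)) (Shape.order τ)))

  legs-at gap-at : Fin (length (shapes n)) → ℕ
  legs-at i = proj₁ (lookup (shapes n) i)
  gap-at  i = proj₂ (lookup (shapes n) i)

  shape-at : ∀ i → Shape n (legs-at i) (gap-at i)
  shape-at i = shapes⁻ (legs-at i) (∈-lookup i)

  tree-at : Fin (length (shapes n)) → Setoid.Carrier (minusCriticalTrees 2 n)
  tree-at i = shape-tree {legs-at i} {gap-at i} (shape-at i)

  shapes-complete : ∀ {G a e} (σ : Shape n a e) →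
    Barbell._∼_ (legs a (a + e)) (Shape.bar σ) ≃ Graph._~_ G →
    ∃[ i ] shape-graph {legs-at i} {gap-at i} (shape-at i) ≅ G
  shapes-complete {G} {a} {e} σ I = index a,e∈ , found (index a,e∈) (sym (lookup-index a,e∈))
    where
    a,e∈ : (a , e) ∈ˡ shapes n
    a,e∈ = shapes⁺ σ

    same-shape : ∀ {a′ e′} → (a′ , e′) ≡ (a , e) → (τ : Shape n a′ e′) → shape-graph τ ≅ G
    same-shape refl τ = ≃⇒≅ {G = shape-graph τ} {G} (≃-trans (≃-sym (shape-iso τ))
      (subst (λ c → Barbell._∼_ (legs a (a + e)) c ≃ Graph._~_ G) (bar-unique σ τ) I))

    found : ∀ i → lookup (shapes n) i ≡ (a , e) → shape-graph {legs-at i} {gap-at i} (shape-at i) ≅ G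
    found i eq = same-shape {legs-at i} {gap-at i} eq (shape-at i)

  classified : ∀ (T : Setoid.Carrier (minusCriticalTrees 2 n)) →
    ∃[ i ] shape-graph {legs-at i} {gap-at i} (shape-at i) ≅ proj₁ T
  classified (G , tree , crit) = let a , e , σ , I = classify G 5≤n tree crit in
    shapes-complete {G} σ I

  trees-counted : HasCardinality (minusCriticalTrees 2 n) (length (shapes n))
  trees-counted = record
    { to        = tree-at
    ; cong      = λ { {i} refl → Setoid.refl (minusCriticalTrees 2 n) {tree-at i} }
    ; bijective =
        (λ {i} {j} iso → lookup-injective (shapes-unique n) (shape-unique {legs-at i} {gap-at i} {legs-at j} {gap-at j} (shape-at i) (shape-at j) iso)) ,
        λ T → proj₁ (classified T) , λ { refl → proj₂ (classified T) }
    }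

-- Evaluation in the four residue classes

length-shapes : ∀ n → length (shapes n) ≡ length (wedge (⌊ n /2⌋ ∸ 3)) + (⌈ n /2⌉ ∸ 2)
length-shapes n = length-extend {wedge (⌊ n /2⌋ ∸ 3)}

⌊j*4/2⌋ : ∀ j → ⌊ j * 4 /2⌋ ≡ j + j
⌊j*4/2⌋ zero    = refl
⌊j*4/2⌋ (suc j) = cong suc (trans (cong suc (⌊j*4/2⌋ j)) (sym (ℕₚ.+-suc j j)))

⌈j*4/2⌉ : ∀ j → ⌈ j * 4 /2⌉ ≡ j + j
⌈j*4/2⌉ zero    = refl
⌈j*4/2⌉ (suc j) = cong suc (trans (cong suc (⌈j*4/2⌉ j)) (sym (ℕₚ.+-suc j j)))

-- The index `2j - 1` arises for `n = 4 (j + 1)` and for its successor; at `j = 0` it truncates to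
-- zero, where the square is right as well.
length-wedge-pred : ∀ j → length (wedge (j + j ∸ 1)) ≡ j * j
length-wedge-pred zero    = refl
length-wedge-pred (suc j) =
  trans (cong (λ m → length (wedge m)) (ℕₚ.+-suc j j)) (length-wedge-odd j)

count : ∀ n {w m x y} → ⌊ n /2⌋ ∸ 3 ≡ w → ⌈ n /2⌉ ∸ 2 ≡ m → length (wedge w) ≡ x → x + m ≡ y →
  length (shapes n) ≡ y
count n refl refl refl refl = length-shapes n

count₀ : ∀ j → length (shapes (suc j * 4)) ≡ suc j ^ 2 ∸ 1
count₀ j = count (suc j * 4) (cong (_∸ 1) (⌊j*4/2⌋ j)) (⌈j*4/2⌉ j) (length-wedge-pred j)
  -- The left side is written as `(1 + x) ∸ 1`, so that the identity to be solved is free of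
  -- subtraction.
  (cong (_∸ 1) (solve 1 (λ j → con 1 :+ (j :* j :+ (j :+ j))
    := (con 1 :+ j) :* ((con 1 :+ j) :* con 1)) refl j))

count₁ : ∀ j → length (shapes (1 + suc j * 4)) ≡ suc j ^ 2
count₁ j = count (1 + suc j * 4) (cong (_∸ 1) (⌈j*4/2⌉ j)) (cong suc (⌊j*4/2⌋ j)) (length-wedge-pred j)
  (solve 1 (λ j → j :* j :+ (con 1 :+ (j :+ j)) := (con 1 :+ j) :* ((con 1 :+ j) :* con 1)) refl j)

count₂ : ∀ j → length (shapes (2 + suc j * 4)) ≡ suc j * (suc j + 1) ∸ 1
count₂ j = count (2 + suc j * 4) (⌊j*4/2⌋ j) (cong suc (⌈j*4/2⌉ j)) (length-wedge-even j)
  (cong (_∸ 1) (solve 1 (λ j → con 1 :+ (j :* (con 1 :+ j) :+ (con 1 :+ (j :+ j)))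
    := (con 1 :+ j) :* ((con 1 :+ j) :+ con 1)) refl j))

count₃ : ∀ j → length (shapes (3 + suc j * 4)) ≡ suc j * (suc j + 1)
count₃ j = count (3 + suc j * 4) (⌈j*4/2⌉ j) (cong (2 +_) (⌊j*4/2⌋ j)) (length-wedge-even j)
  (solve 1 (λ j → j :* (con 1 :+ j) :+ (con 2 :+ (j :+ j))
    := (con 1 :+ j) :* ((con 1 :+ j) :+ con 1)) refl j)

counted : ∀ {n} r (f : ℕ → ℕ) → r ≤ 4 → (∀ j → length (shapes (r + suc j * 4)) ≡ f (suc j)) →
  5 ≤ n → n % 4 ≡ r → HasCardinality (minusCriticalTrees 2 n) (f (n / 4))
counted {n} r f r≤4 count-r 5≤n n%4≡r =
  subst (HasCardinality (minusCriticalTrees 2 n)) (number (n / 4) n≡) (trees-counted 5≤n)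
  where
  n≡ : n ≡ r + n / 4 * 4
  n≡ = trans (m≡m%n+[m/n]*n n 4) (cong (_+ n / 4 * 4) n%4≡r)

  number : ∀ q → n ≡ r + q * 4 → length (shapes n) ≡ f q
  number zero    eq = contradiction
    (≤-trans 5≤n (≤-trans (ℕₚ.≤-reflexive (trans eq (ℕₚ.+-identityʳ r))) r≤4)) (ℕₚ.<⇒≱ ≤-refl)
  number (suc j) eq = trans (cong (λ m → length (shapes m)) eq) (count-r j)

theorem2p7 : (n : ℕ) → 5 ≤ n →
    (n % 4 ≡ 0 → HasCardinality (minusCriticalTrees 2 n) ((n / 4) ^ 2 ∸ 1))
    × (n % 4 ≡ 1 → HasCardinality (minusCriticalTrees 2 n) ((n / 4) ^ 2))
    × (n % 4 ≡ 2 → HasCardinality (minusCriticalTrees 2 n) ((n / 4) * (n / 4 + 1) ∸ 1))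
    × (n % 4 ≡ 3 → HasCardinality (minusCriticalTrees 2 n) ((n / 4) * (n / 4 + 1)))
theorem2p7 n 5≤n =
  counted 0 (λ q → q ^ 2 ∸ 1)       z≤n                   count₀ 5≤n ,
  counted 1 (λ q → q ^ 2)           (s≤s z≤n)             count₁ 5≤n ,
  counted 2 (λ q → q * (q + 1) ∸ 1) (s≤s (s≤s z≤n))       count₂ 5≤n ,
  counted 3 (λ q → q * (q + 1))     (s≤s (s≤s (s≤s z≤n))) count₃ 5≤n
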